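{- For every integer $k\ge 3$ and every graph $F$ of maximum degree at most $k$, if a $k$-edge-connected graph $G$ contains a vertex with at least $d(k)|V(F)|$ distinct neighbors, where $d(k)=(2k+1)^{8k+4}k^2(k+1)$, then $F$ appears in $G$ as a strong immersion.
   Context: Graphs are finite and may have parallel edges and loops; each loop contributes $2$ to the degree of its vertex. An immersion of a graph $H$ in a graph $G$ is a function $\theta$ on the vertices and edges of $H$ such that: (a) $\theta(v)$ is a vertex of $G$ for each $v\in V(H)$, and $\theta$ restricted to $V(H)$ is injective; (b) $\theta(e)$ is a connected subgraph of $G$ for each $e\in E(H)$, and for distinct $e,f\in E(H)$ the subgraphs $\theta(e)$ and $\theta(f)$ are edge-disjoint; (c) if $e\in E(H)$ is incident with $v\in V(H)$, then $\theta(v)$ is a vertex of $\theta(e)$, and if $e$ is a loop, then $\theta(e)$ contains a cycle passing through $\theta(v)$. The immersion is strong if, in addition, whenever $e\in E(H)$ is not incident with $v\in V(H)$, $\theta(e)$ does not contain $\theta(v)$. "$F$ appears in $G$ as a strong immersion" means that there is a strong immersion of $F$ in $G$. -}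

module Defs where

open import Data.Fin using (Fin; _≟_)
open import Data.Fin.Subset using (Subset; _∈_; _∉_; _∩_; ∁; ⊤; ∣_∣; Nonempty; Empty)
open import Data.Fin.Subset.Properties using (∈⊤)
open import Data.List using (List; []; _∷_)
open import Data.List.Relation.Unary.Unique.Propositional using (Unique)
open import Data.Nat using (ℕ; _+_; _*_; _^_; _≤_; _<_; _≥_)
open import Data.Product using (Σ; ∃-syntax; _×_; _,_; proj₁; proj₂)
open import Data.Sum using (_⊎_)
open import Data.Vec using (tabulate)
open import Function.Definitions using (Injective)
open import Relation.Binary.Construct.Closure.ReflexiveTransitive using (Star; ε; _◅_)
open import Relation.Binary.PropositionalEquality using (_≡_; _≢_)
open import Relation.Nullary using (¬_; does)

-- Finite multigraphs with loops.  The order of the two ends of an edge carries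
-- no meaning: every notion below is symmetric in them.
record Graph : Set where
  field
    #V   : ℕ
    #E   : ℕ
    ends : Fin #E → Fin #V × Fin #V

  Vertex : Set
  Vertex = Fin #V

  Edge : Set
  Edge = Fin #E

  Joins : Edge → Vertex → Vertex → Set
  Joins e u v = ends e ≡ (u , v) ⊎ ends e ≡ (v , u)

  Incident : Edge → Vertex → Set
  Incident e v = proj₁ (ends e) ≡ v ⊎ proj₂ (ends e) ≡ v

  LoopAt : Edge → Vertex → Set
  LoopAt e v = ends e ≡ (v , v)

  -- A loop at v is counted once in each summand.
  degree : Vertex → ℕ
  degree v = ∣ tabulate (λ e → does (proj₁ (ends e) ≟ v)) ∣
           + ∣ tabulate (λ e → does (proj₂ (ends e) ≟ v)) ∣

  -- A vertex is not its own neighbour, even if it carries a loop.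
  Neighbour : Vertex → Vertex → Set
  Neighbour v w = w ≢ v × ∃[ e ] Joins e v w

  AtLeastNeighbours : ℕ → Vertex → Set
  AtLeastNeighbours n v =
    Σ (Subset #V) λ S → ∣ S ∣ ≥ n × (∀ {w} → w ∈ S → Neighbour v w)

  Step : Subset #E → Vertex → Vertex → Set
  Step A u v = ∃[ e ] (e ∈ A × Joins e u v)

  Walk : Subset #E → Vertex → Vertex → Set
  Walk A = Star (Step A)

  walkEdges : ∀ {A u v} → Walk A u v → List Edge
  walkEdges ε             = []
  walkEdges ((e , _) ◅ p) = e ∷ walkEdges p

  -- The vertices of a walk in order, without the final one.
  walkVertices : ∀ {A u v} → Walk A u v → List Vertex
  walkVertices ε               = []
  walkVertices {u = u} (_ ◅ p) = u ∷ walkVertices p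

  -- Some cycle with edges in A passes through v.  A loop is a cycle of length
  -- one and two parallel edges form a cycle of length two; distinctness of the
  -- edges prevents traversing a single edge back and forth.
  CycleThrough : Subset #E → Vertex → Set
  CycleThrough A v = Σ (Walk A v v) λ p →
    walkEdges p ≢ [] × Unique (walkVertices p) × Unique (walkEdges p)

open Graph using (#V; #E; ends; Vertex; Edge; Incident; LoopAt; degree;
                  AtLeastNeighbours; Walk; CycleThrough) public

MaxDegree≤ : ℕ → Graph → Set
MaxDegree≤ k G = ∀ v → degree G v ≤ k

record Subgraph (G : Graph) : Set where
  field
    V      : Subset (#V G)
    E      : Subset (#E G)
    closed : ∀ {e} → e ∈ E → proj₁ (ends G e) ∈ V × proj₂ (ends G e) ∈ V

Connected : ∀ {G} → Subgraph G → Set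
Connected {G} H = Nonempty V × (∀ {u v} → u ∈ V → v ∈ V → Walk G E u v)
  where open Subgraph H

deleteEdges : (G : Graph) → Subset (#E G) → Subgraph G
deleteEdges G X = record { V = ⊤ ; E = ∁ X ; closed = λ _ → ∈⊤ , ∈⊤ }

EdgeConnected : ℕ → Graph → Set
EdgeConnected k G = ∀ X → ∣ X ∣ < k → Connected (deleteEdges G X)

record Immersion (F G : Graph) : Set where
  open Subgraph
  field
    θV           : Vertex F → Vertex G
    θE           : Edge F → Subgraph G
    injective    : Injective _≡_ _≡_ θV
    connected    : ∀ e → Connected (θE e)
    edgeDisjoint : ∀ {e f} → e ≢ f → Empty (E (θE e) ∩ E (θE f))
    incident     : ∀ {e v} → Incident F e v → θV v ∈ V (θE e)
    loop         : ∀ {e v} → LoopAt F e v → CycleThrough G (E (θE e)) (θV v)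

Strong : ∀ {F G} → Immersion F G → Set
Strong {F} θ = ∀ {e v} → ¬ Incident F e v → θV v ∉ Subgraph.V (θE e)
  where open Immersion θ

StrongImmersion : Graph → Graph → Set
StrongImmersion F G = Σ (Immersion F G) Strong

d : ℕ → ℕ
d k = (2 * k + 1) ^ (8 * k + 4) * k ^ 2 * (k + 1)

-- Write S for the set of neighbours of v.  Delete edges as long as every s ∈ S keeps an edge to v
-- and k edge-disjoint paths to v.  Afterwards almost every edge crosses a tight set, that is, a
-- set with at most k boundary edges that meets S and misses v, and uncrossing yields disjoint
-- tight cells such that almost every edge has an end in a cell.  Each cell contains a vertex of S,
-- its root.  The remaining vertices other than v (hubs) are practically adjacent to cells and v
-- only.  The edges at a hub are split into classes of size between k² and 2k², so that "sharing a
-- boundary edge, up to classes" is an adjacency of bounded degree on the cells.  The edges around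
-- the cells at distance less than k from a given cell contain k edge-disjoint paths from its root
-- to v: a smaller cut would either be crossed at k different cells, or split a large class, or
-- contradict the choice of the edge set.  Since degrees are bounded, a greedy choice gives |V(F)|
-- cells whose surroundings are edge-disjoint, and F is immersed with their roots as branch
-- vertices, the two half-edges of an edge of F being realized by two of the paths to v.

module Submission where

open import Axiom.UniquenessOfIdentityProofs using (module Decidable⇒UIP)
open import Data.Bool using (Bool; true; false; _∧_; _∨_; not; _xor_; if_then_else_)
import Data.Bool as Bool
open import Data.Bool.Properties using (T-≡)
open import Data.Empty using (⊥; ⊥-elim)
open import Data.Fin using (Fin; zero; suc; _≟_; toℕ; fromℕ<)
open import Data.Fin.Properties using (any?; all?; suc-injective; toℕ-fromℕ<)
open import Data.Fin.Subset using (Subset; _∈_; ∣_∣)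
open import Data.Fin.Subset.Properties using (∈⊤; x∈p∩q⁻; x∈∁p⇒x∉p)
open import Data.List using (List; []; _∷_; allFin)
open import Data.List.Membership.Propositional using () renaming (_∈_ to _∈ˡ_)
open import Data.List.Membership.Propositional.Properties using (∈-allFin)
open import Data.List.Relation.Unary.All using (All; []; _∷_)
open import Data.List.Relation.Unary.All.Properties using (¬Any⇒All¬)
open import Data.List.Relation.Unary.AllPairs using ([]; _∷_)
import Data.List.Relation.Unary.Any as Any
open import Data.List.Relation.Unary.Any using (here; there)
open import Data.List.Relation.Unary.Unique.Propositional using (Unique)
open import Data.Maybe using (Maybe; just; nothing)
import Data.Nat as ℕ
open import Data.Nat using (ℕ; zero; suc; _+_; _*_; _^_; _≤_; _<_; _≥_; z≤n; s≤s; _≤?_; _≤ᵇ_; >-nonZero)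
open import Data.Nat.Properties hiding (_≟_; suc-injective; ≡-irrelevant)
open import Data.Nat.Solver using (module +-*-Solver)
open import Data.Product using (Σ; ∃-syntax; _×_; _,_; proj₁; proj₂)
open import Data.Sum using (_⊎_; inj₁; inj₂)
open import Data.Unit using (⊤; tt)
open import Data.Vec using ([]; _∷_; lookup; tabulate)
open import Data.Vec.Functional using () renaming (_∷_ to _◂_)
open import Data.Vec.Properties using (lookup⇒[]=; []=⇒lookup; lookup∘tabulate)
open import Function using (_∘_)
open import Function.Bundles using (Equivalence)
open import Relation.Binary.Construct.Closure.ReflexiveTransitive using (Star; ε; _◅_; _◅◅_; reverse) renaming (map to mapStar)
open import Relation.Binary.PropositionalEquality using (_≡_; _≢_; refl; sym; trans; cong; cong₂; subst)
open import Relation.Nullary using (¬_; Dec; yes; no; does; contradiction)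
open import Relation.Nullary.Decidable using (dec-true; dec-false; ¬?; _×-dec_; _→-dec_; _⊎-dec_; decidable-stable)
open import Defs

-- The obstacle is that degrees are bounded only at cells: a hub may have arbitrarily many edges, so
-- a search that passes freely through hubs could reach the whole graph and no two surroundings
-- would be edge-disjoint. Classes stop the search at a hub, but a cut may then separate one class
-- from the rest of the star. The lower bound on class sizes repairs this: a few cells cannot absorb
-- a large class, so many of its edges cross the cut.
--
-- The radius k - 1 comes from a breadth-first search among the cells inside a cut. Each step of
-- growth adds a cell with a crossing edge of its own, so k - 1 steps produce k crossing edges. A
-- search that stops earlier encloses a set to which the cut condition on the pruned edge set
-- applies directly.
--
-- Uncrossing loses nothing because the bound k is met from both sides: tight sets have at most k
-- boundary edges, and every set that meets S and misses v has at least k. Menger's theorem is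
-- proved with the extra clause that every edge of a path leads on to v along that path, so the
-- union of two paths is connected and needs no trimming.

Pred : ℕ → Set
Pred n = Fin n → Bool

infix 4 _∋_ _∌_
_∋_ _∌_ : ∀ {n} → Pred n → Fin n → Set
p ∋ i = p i ≡ true
p ∌ i = p i ≡ false

does⁻ : ∀ {A : Set} (d : Dec A) → does d ≡ true → A
does⁻ (yes a) _ = a

∧⁻ˡ : ∀ a {b} → a ∧ b ≡ true → a ≡ true
∧⁻ˡ true _ = refl

∧⁻ʳ : ∀ a {b} → a ∧ b ≡ true → b ≡ true
∧⁻ʳ true eq = eq

∧⁺ : ∀ {a b} → a ≡ true → b ≡ true → a ∧ b ≡ true
∧⁺ refl refl = refl

∨⁻ : ∀ a {b} → a ∨ b ≡ true → a ≡ true ⊎ b ≡ true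
∨⁻ true  _  = inj₁ refl
∨⁻ false eq = inj₂ eq

∨⁺ˡ : ∀ {a} b → a ≡ true → a ∨ b ≡ true
∨⁺ˡ b refl = refl

∨⁺ʳ : ∀ a {b} → b ≡ true → a ∨ b ≡ true
∨⁺ʳ true  _  = refl
∨⁺ʳ false eq = eq

not⁺ : ∀ {a} → a ≡ false → not a ≡ true
not⁺ refl = refl

not⁻ : ∀ {a} → not a ≡ true → a ≡ false
not⁻ {false} _ = refl

true≢false : ∀ {a} → a ≡ true → a ≡ false → ⊥
true≢false refl ()

¬true : ∀ {a} → ¬ (a ≡ true) → a ≡ false
¬true {true}  n = ⊥-elim (n refl)
¬true {false} _ = refl

dichotomy : ∀ a → a ≡ true ⊎ a ≡ false
dichotomy true  = inj₁ refl
dichotomy false = inj₂ refl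

_==_ : ∀ {n} → Fin n → Fin n → Bool
i == j = does (i ≟ j)

==⁻ : ∀ {n} (i j : Fin n) → (i == j) ≡ true → i ≡ j
==⁻ i j = does⁻ (i ≟ j)

==-refl : ∀ {n} (i : Fin n) → (i == i) ≡ true
==-refl i = dec-true (i ≟ i) refl

==⁺ : ∀ {n} {i j : Fin n} → i ≡ j → (i == j) ≡ true
==⁺ {i = i} refl = ==-refl i

≢⁺ : ∀ {n} {i j : Fin n} → i ≢ j → (i == j) ≡ false
≢⁺ {i = i} {j} = dec-false (i ≟ j)

-- Counting

bit : Bool → ℕ
bit true  = 1
bit false = 0

count : ∀ {n} → Pred n → ℕ
count {zero}  p = 0
count {suc n} p = bit (p zero) + count (p ∘ suc)

bit-mono : ∀ {a b} → (a ≡ true → b ≡ true) → bit a ≤ bit b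
bit-mono {true}  h rewrite h refl = ≤-refl
bit-mono {false} h = z≤n

count-mono : ∀ {n} {p q : Pred n} → (∀ i → p ∋ i → q ∋ i) → count p ≤ count q
count-mono {zero}  h = z≤n
count-mono {suc n} h = +-mono-≤ (bit-mono (h zero)) (count-mono (h ∘ suc))

count-cong : ∀ {n} {p q : Pred n} → (∀ i → p i ≡ q i) → count p ≡ count q
count-cong {zero}  h = refl
count-cong {suc n} h = cong₂ _+_ (cong bit (h zero)) (count-cong (h ∘ suc))

count-strict : ∀ {n} {p q : Pred n} → (∀ i → p ∋ i → q ∋ i) →
               ∀ i → q ∋ i → p ∌ i → count p < count q
count-strict {suc n} h zero    qi pi rewrite qi | pi = s≤s (count-mono (h ∘ suc))
count-strict {suc n} {p} {q} h (suc i) qi pi =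
  subst (_≤ count q) (+-suc (bit (p zero)) (count (p ∘ suc)))
    (+-mono-≤ (bit-mono (h zero)) (count-strict (h ∘ suc) i qi pi))

interchange : ∀ a b c d → (a + b) + (c + d) ≡ (a + c) + (b + d)
interchange = solve 4 (λ a b c d → (a :+ b) :+ (c :+ d) := (a :+ c) :+ (b :+ d)) refl
  where open +-*-Solver

-- This is the shape of a submodular inequality, with two counts on each side. It reduces such
-- inequalities for cuts to a check of one edge at a time.
count-uncross : ∀ {n} {p q r s : Pred n} →
  (∀ i → bit (p i) + bit (q i) ≤ bit (r i) + bit (s i)) →
  count p + count q ≤ count r + count s
count-uncross {zero}  h = z≤n
count-uncross {suc n} {p} {q} {r} {s} h = begin
  (bit (p zero) + count (p ∘ suc)) + (bit (q zero) + count (q ∘ suc))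
    ≡⟨ interchange (bit (p zero)) _ (bit (q zero)) _ ⟩
  (bit (p zero) + bit (q zero)) + (count (p ∘ suc) + count (q ∘ suc))
    ≤⟨ +-mono-≤ (h zero) (count-uncross (h ∘ suc)) ⟩
  (bit (r zero) + bit (s zero)) + (count (r ∘ suc) + count (s ∘ suc))
    ≡⟨ interchange (bit (r zero)) (bit (s zero)) _ _ ⟩
  (bit (r zero) + count (r ∘ suc)) + (bit (s zero) + count (s ∘ suc)) ∎
  where open ≤-Reasoning

count-uncross-strict : ∀ {n} {p q r s : Pred n} →
  (∀ i → bit (p i) + bit (q i) ≤ bit (r i) + bit (s i)) →
  ∀ i → bit (p i) + bit (q i) < bit (r i) + bit (s i) →
  count p + count q < count r + count s
count-uncross-strict {suc n} {p} {q} {r} {s} h i hi = begin-strict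
  (bit (p zero) + count (p ∘ suc)) + (bit (q zero) + count (q ∘ suc))
    ≡⟨ interchange (bit (p zero)) _ (bit (q zero)) _ ⟩
  (bit (p zero) + bit (q zero)) + (count (p ∘ suc) + count (q ∘ suc))
    <⟨ step i hi ⟩
  (bit (r zero) + bit (s zero)) + (count (r ∘ suc) + count (s ∘ suc))
    ≡⟨ interchange (bit (r zero)) (bit (s zero)) _ _ ⟩
  (bit (r zero) + count (r ∘ suc)) + (bit (s zero) + count (s ∘ suc)) ∎
  where
  open ≤-Reasoning
  step : ∀ i → bit (p i) + bit (q i) < bit (r i) + bit (s i) →
         (bit (p zero) + bit (q zero)) + (count (p ∘ suc) + count (q ∘ suc)) <
         (bit (r zero) + bit (s zero)) + (count (r ∘ suc) + count (s ∘ suc))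
  step zero    lt = +-mono-<-≤ lt (count-uncross (h ∘ suc))
  step (suc i) lt = +-mono-≤-< (h zero) (count-uncross-strict (h ∘ suc) i lt)

count-none : ∀ {n} {p : Pred n} → (∀ i → p ∌ i) → count p ≡ 0
count-none {zero}  h = refl
count-none {suc n} h rewrite h zero = count-none (h ∘ suc)

count≥1 : ∀ {n} {p : Pred n} i → p ∋ i → 1 ≤ count p
count≥1 {n} {p} i pi =
  subst (_< count p) (count-none {n} {λ _ → false} λ _ → refl) (count-strict {p = λ _ → false} (λ _ ()) i pi refl)

count≤1 : ∀ {n} {p : Pred n} → (∀ i j → p ∋ i → p ∋ j → i ≡ j) → count p ≤ 1
count≤1 {zero}  h = z≤n
count≤1 {suc n} {p} h with p zero in eq
... | true  = ≤-reflexive (cong suc (count-none λ i → ¬true λ pi → absurd (h zero (suc i) eq pi)))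
  where
  absurd : ∀ {i : Fin n} → zero ≡ suc i → ⊥
  absurd ()
... | false = count≤1 λ i j pi pj → suc-inj (h (suc i) (suc j) pi pj)
  where
  suc-inj : ∀ {i j : Fin n} → suc i ≡ suc j → i ≡ j
  suc-inj refl = refl

==-count : ∀ {n} (i : Fin n) → count (i ==_) ≤ 1
==-count i = count≤1 {p = i ==_} λ j k p q → trans (sym (==⁻ i j p)) (==⁻ i k q)

count-== : ∀ {n} (i : Fin n) → count (_== i) ≤ 1
count-== i = count≤1 {p = _== i} λ j k p q → trans (==⁻ j i p) (sym (==⁻ k i q))

count-∨ : ∀ {n} (p q : Pred n) → count (λ i → p i ∨ q i) ≤ count p + count q
count-∨ {n} p q = subst (_≤ count p + count q)
  (trans (cong (count (λ i → p i ∨ q i) +_) (count-none {n} {λ i → false} λ _ → refl)) (+-identityʳ _))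
  (count-uncross λ i → bits (p i) (q i))
  where
  bits : ∀ a b → bit (a ∨ b) + 0 ≤ bit a + bit b
  bits true  b     = s≤s z≤n
  bits false true  = ≤-refl
  bits false false = z≤n

count-split : ∀ {n} {p q r : Pred n} → (∀ i → p ∋ i → q ∋ i ⊎ r ∋ i) → count p ≤ count q + count r
count-split {p = p} {q} {r} h = ≤-trans (count-mono λ i pi → join i (h i pi)) (count-∨ q r)
  where
  join : ∀ i → q ∋ i ⊎ r ∋ i → q i ∨ r i ≡ true
  join i (inj₁ e) = ∨⁺ˡ _ e
  join i (inj₂ e) = ∨⁺ʳ (q i) e

count-all : ∀ {n} → count {n} (λ _ → true) ≡ n
count-all {zero}  = refl
count-all {suc n} = cong suc count-all

-- The union bound behind all degree estimates. In the induction an element is charged to the first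
-- index of `p` that covers it, and `rest` keeps what is still uncharged.
count-cover : ∀ {a b} (p : Pred a) (q : Pred b) (R : Fin a → Pred b) d →
  (∀ i → p ∋ i → count (R i) ≤ d) → (∀ j → q ∋ j → ∃[ i ] (p ∋ i × R i ∋ j)) →
  count q ≤ count p * d
count-cover {zero} p q R d bd cov = ≤-reflexive (count-none λ j → ¬true λ qj → none (proj₁ (cov j qj)))
  where
  none : Fin 0 → ⊥
  none ()
count-cover {suc a} {b} p q R d bd cov = begin
  count q                                ≤⟨ count-split {q = first} {rest} splitting ⟩
  count first + count rest               ≤⟨ +-mono-≤ (firstBound (p zero) refl)
                                             (count-cover (p ∘ suc) rest (R ∘ suc) d (bd ∘ suc) later) ⟩
  bit (p zero) * d + count (p ∘ suc) * d ≡⟨ sym (*-distribʳ-+ d (bit (p zero)) _) ⟩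
  count p * d                            ∎
  where
  open ≤-Reasoning
  first rest : Pred b
  first j = p zero ∧ R zero j
  rest  j = q j ∧ not (first j)
  splitting : ∀ j → q ∋ j → first ∋ j ⊎ rest ∋ j
  splitting j qj with first j
  ... | true  = inj₁ refl
  ... | false rewrite qj = inj₂ refl
  firstBound : ∀ c → p zero ≡ c → count first ≤ bit (p zero) * d
  firstBound true  e rewrite e = ≤-trans (bd zero e) (≤-reflexive (sym (+-identityʳ d)))
  firstBound false e rewrite e = ≤-reflexive (count-none {b} λ _ → refl)
  later : ∀ j → rest ∋ j → ∃[ i ] (p (suc i) ≡ true × R (suc i) ∋ j)
  later j rj with cov j (∧⁻ˡ (q j) rj)
  ... | zero  , pi , Rj = ⊥-elim (true≢false (∧⁺ pi Rj) (not⁻ (∧⁻ʳ (q j) rj)))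
  ... | suc i , pi , Rj = i , pi , Rj

count-inject : ∀ {a b} (p : Pred a) (q : Pred b) (R : Fin a → Fin b → Set) →
  (∀ i → p ∋ i → ∃[ j ] (q ∋ j × R i j)) → (∀ {i i' j} → R i j → R i' j → i ≡ i') →
  count p ≤ count q
count-inject {a} {b} p q R f inj = subst (count p ≤_) (*-identityʳ _)
  (count-cover q p (λ j i → chosen i (p i) refl j) 1
    (λ j _ → count≤1 λ i i' c c' → inj (valid i (p i) refl j c) (valid i' (p i') refl j c'))
    (λ i pi → let j , qj , _ = f i pi in j , qj , picked i (p i) refl pi))
  where
  chosen : ∀ i β → p i ≡ β → Pred b
  chosen i true  e j = proj₁ (f i e) == j
  chosen i false e j = false
  valid : ∀ i β (e : p i ≡ β) j → chosen i β e j ≡ true → R i j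
  valid i true e j c = subst (R i) (==⁻ _ j c) (proj₂ (proj₂ (f i e)))
  picked : ∀ i β (e : p i ≡ β) (pi : p i ≡ true) → chosen i β e (proj₁ (f i pi)) ≡ true
  -- `f i` may depend on the proof that `p ∋ i`, so the proofs `e` and `pi` have to be identified
  -- before the two choices agree.
  picked i true  e pi rewrite Decidable⇒UIP.≡-irrelevant Bool._≟_ e pi = ==-refl (proj₁ (f i pi))
  picked i false e pi = ⊥-elim (true≢false pi e)

subset-of-size : ∀ {n} (p : Pred n) s → s ≤ count p →
  ∃[ q ] ((∀ i → q ∋ i → p ∋ i) × count q ≡ s)
subset-of-size {n} p zero _ = (λ _ → false) , (λ _ ()) , count-none {n} λ _ → refl
subset-of-size {suc n} p (suc s) le with p zero in eq
... | true with subset-of-size (p ∘ suc) s (≤-pred le)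
...   | q , sub , sz = q⁺ , sub⁺ , cong suc sz
  where
  q⁺ : Pred (suc n)
  q⁺ zero    = true
  q⁺ (suc i) = q i
  sub⁺ : ∀ i → q⁺ ∋ i → p ∋ i
  sub⁺ zero    _ = eq
  sub⁺ (suc i) e = sub i e
subset-of-size {suc n} p (suc s) le | false with subset-of-size (p ∘ suc) (suc s) le
... | q , sub , sz = q⁺ , sub⁺ , sz
  where
  q⁺ : Pred (suc n)
  q⁺ zero    = false
  q⁺ (suc i) = q i
  sub⁺ : ∀ i → q⁺ ∋ i → p ∋ i
  sub⁺ (suc i) e = sub i e

count-minus : ∀ {n} {p q : Pred n} → (∀ i → q ∋ i → p ∋ i) →
  count p ≡ count q + count (λ i → p i ∧ not (q i))
count-minus {zero}  h = refl
count-minus {suc n} {p} {q} h = trans (cong₂ _+_ (head (p zero) (q zero) (h zero)) (count-minus (h ∘ suc)))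
  (interchange (bit (q zero)) (bit (p zero ∧ not (q zero))) _ _)
  where
  head : ∀ a b → (b ≡ true → a ≡ true) → bit a ≡ bit b + bit (a ∧ not b)
  head true  true  _ = refl
  head true  false _ = refl
  head false false _ = refl
  head false true  k with k refl
  ... | ()

-- Quantification over subsets

-- Subsets are functions and the enumeration rebuilds each of them from its values, so it meets a
-- given subset only up to pointwise equality.
Extensional : ∀ {n} → (Pred n → Set) → Set
Extensional P = ∀ {p q} → (∀ i → p i ≡ q i) → P p → P q

decAll : ∀ {n} (P : Pred n → Set) → Extensional P → (∀ p → Dec (P p)) → (∀ p → P p) ⊎ ∃[ p ] (¬ P p)
decAll {zero} P ext P? with P? (λ ())
... | yes h = inj₁ λ p → ext (λ ()) h
... | no  h = inj₂ (_ , h)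
decAll {suc n} P ext P?
  with decAll (P ∘ (true ◂_)) (λ e → ext λ { zero → refl ; (suc i) → e i }) (P? ∘ (true ◂_))
     | decAll (P ∘ (false ◂_)) (λ e → ext λ { zero → refl ; (suc i) → e i }) (P? ∘ (false ◂_))
... | inj₂ (p , h) | _ = inj₂ (_ , h)
... | inj₁ _ | inj₂ (p , h) = inj₂ (_ , h)
... | inj₁ f | inj₁ g = inj₁ λ p → all p (p zero) refl
  where
  all : ∀ p b → p zero ≡ b → P p
  all p true  e = ext (λ { zero → sym e ; (suc i) → refl }) (f (p ∘ suc))
  all p false e = ext (λ { zero → sym e ; (suc i) → refl }) (g (p ∘ suc))

-- Boolean inequalities are verified by evaluating them at all points.

allBool : (Bool → Bool) → Bool
allBool f = f true ∧ f false

allBool⁻ : ∀ f → allBool f ≡ true → ∀ b → f b ≡ true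
allBool⁻ f h true  = ∧⁻ˡ (f true) h
allBool⁻ f h false = ∧⁻ʳ (f true) h

pointwise₄ : (x y : Bool → Bool → Bool → Bool → ℕ) →
  (allBool λ a → allBool λ b → allBool λ c → allBool λ d → x a b c d ≤ᵇ y a b c d) ≡ true →
  ∀ a b c d → x a b c d ≤ y a b c d
pointwise₄ x y h a b c d = ≤ᵇ⇒≤ _ _ (Equivalence.from T-≡
  (allBool⁻ (λ d → x a b c d ≤ᵇ y a b c d)
  (allBool⁻ (λ c → allBool λ d → x a b c d ≤ᵇ y a b c d)
  (allBool⁻ (λ b → allBool λ c → allBool λ d → x a b c d ≤ᵇ y a b c d)
  (allBool⁻ (λ a → allBool λ b → allBool λ c → allBool λ d → x a b c d ≤ᵇ y a b c d) h a) b) c) d))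

_∩ᵖ_ _∪ᵖ_ _∖ᵖ_ : ∀ {n} → Pred n → Pred n → Pred n
(X ∩ᵖ Y) x = X x ∧ Y x
(X ∪ᵖ Y) x = X x ∨ Y x
(X ∖ᵖ Y) x = X x ∧ not (Y x)

search : ∀ {m} {P Q : Fin m → Set} → (∀ e → P e ⊎ Q e) → (∃[ e ] P e) ⊎ (∀ e → Q e)
search {zero}  f = inj₂ λ ()
search {suc m} f with f zero | search (f ∘ suc)
... | inj₁ p | _ = inj₁ (zero , p)
... | inj₂ _ | inj₁ (e , p) = inj₁ (suc e , p)
... | inj₂ q | inj₂ g = inj₂ λ { zero → q ; (suc e) → g e }

isJust= : ∀ {k} → Fin k → Maybe (Fin k) → Bool
isJust= i nothing  = false
isJust= i (just j) = i == j

update : ∀ {n} {A : Set} → (Fin n → A) → Fin n → A → Fin n → A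
update f i x j = if j == i then x else f j

update-same : ∀ {n} {A : Set} (f : Fin n → A) i x → update f i x i ≡ x
update-same f i x rewrite ==-refl i = refl

update-other : ∀ {n} {A : Set} (f : Fin n → A) i x {j} → j ≢ i → update f i x j ≡ f j
update-other f i x ne rewrite ≢⁺ ne = refl

-- Arc-disjoint routes to a sink: Menger's theorem for directed graphs

module Directed {n m} (src tgt : Fin m → Fin n) (t : Fin n) {k : ℕ} where

  DStep : Pred m → Fin n → Fin n → Set
  DStep Q x y = ∃[ e ] (Q ∋ e × src e ≡ x × tgt e ≡ y)

  out : Pred m → Pred n → Pred m
  out D X e = D e ∧ (X (src e) ∧ not (X (tgt e)))

  -- The cut condition for tokens with separate positions. Even if all tokens start at one vertex,
  -- the induction moves them one at a time and needs this generality.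
  Feasible : Pred m → (Fin k → Fin n) → Set
  Feasible D a = ∀ X → X ∌ t → count (X ∘ a) ≤ count (out D X)

  owned : (Fin m → Maybe (Fin k)) → Fin k → Pred m
  owned own i e = isJust= i (own e)

  -- Arc-disjointness is encoded by giving every arc at most one owner. The last component is the
  -- extra clause that the images of edges inherit as connectedness.
  Routing : Pred m → (Fin k → Fin n) → Set
  Routing D a = Σ (Fin m → Maybe (Fin k)) λ own →
    (∀ i → Star (DStep (owned own i)) (a i) t) ×
    (∀ i e → owned own i ∋ e → D ∋ e × Star (DStep (owned own i)) (tgt e) t)

  out-submodular : ∀ D X Y →
    count (out D (X ∩ᵖ Y)) + count (out D (X ∪ᵖ Y)) ≤ count (out D X) + count (out D Y)
  out-submodular D X Y = count-uncross λ e → bits (D e) (X (src e)) (X (tgt e)) (Y (src e)) (Y (tgt e))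
    where
    bits : ∀ d xs xt ys yt →
      bit (d ∧ ((xs ∧ ys) ∧ not (xt ∧ yt))) + bit (d ∧ ((xs ∨ ys) ∧ not (xt ∨ yt)))
      ≤ bit (d ∧ (xs ∧ not xt)) + bit (d ∧ (ys ∧ not yt))
    bits false _ _ _ _ = z≤n
    bits true = pointwise₄ _ _ refl

  count-modular : ∀ (X Y : Pred n) (a : Fin k → Fin n) →
    count (X ∘ a) + count (Y ∘ a) ≤ count ((X ∩ᵖ Y) ∘ a) + count ((X ∪ᵖ Y) ∘ a)
  count-modular X Y a = count-uncross λ i → bits (X (a i)) (Y (a i))
    where
    bits : ∀ x y → bit x + bit y ≤ bit (x ∧ y) + bit (x ∨ y)
    bits true  true  = ≤-refl
    bits true  false = ≤-refl
    bits false y     = ≤-refl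

  -- A set without slack: a further token stepping into `X` from `x` would violate `Feasible`.
  Tight : Pred m → (Fin k → Fin n) → Fin n → Pred n → Set
  Tight D a x X = X ∌ t × X ∌ x × count (out D X) ≤ count (X ∘ a)

  tight-∪ : ∀ D a {x X Y} → Feasible D a → Tight D a x X → Tight D a x Y → Tight D a x (X ∪ᵖ Y)
  tight-∪ D a {x} {X} {Y} feas (Xt , Xx , X≤) (Yt , Yx , Y≤) = or Xt Yt , or Xx Yx ,
    +-cancelˡ-≤ (count (out D (X ∩ᵖ Y))) _ _ (begin
      count (out D (X ∩ᵖ Y)) + count (out D (X ∪ᵖ Y)) ≤⟨ out-submodular D X Y ⟩
      count (out D X) + count (out D Y)               ≤⟨ +-mono-≤ X≤ Y≤ ⟩
      count (X ∘ a) + count (Y ∘ a)                   ≤⟨ count-modular X Y a ⟩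
      count ((X ∩ᵖ Y) ∘ a) + count ((X ∪ᵖ Y) ∘ a)     ≤⟨ +-monoˡ-≤ _ (feas (X ∩ᵖ Y) (and Xt)) ⟩
      count (out D (X ∩ᵖ Y)) + count ((X ∪ᵖ Y) ∘ a)   ∎)
    where
    open ≤-Reasoning
    or : ∀ {z} → X ∌ z → Y ∌ z → X z ∨ Y z ≡ false
    or p q rewrite p = q
    and : ∀ {z} → X ∌ z → X z ∧ Y z ≡ false
    and p rewrite p = refl

  gather : ∀ D a {x} → Feasible D a → ∀ {l} (f : Fin l → Fin n) (P : Fin l → Set) →
    (∀ e → Dec (P e)) → (∀ e → P e → ∃[ X ] (Tight D a x X × X ∋ f e)) →
    ∃[ U ] (Tight D a x U × (∀ e → P e → U ∋ f e))
  gather D a feas {zero} f P P? h =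
    (λ _ → false) , (refl , refl , ≤-reflexive (trans (count-none λ e → nothing-out (D e)) (sym (count-none {k} λ _ → refl)))) , λ ()
    where
    nothing-out : ∀ d → d ∧ false ≡ false
    nothing-out true  = refl
    nothing-out false = refl
  gather D a feas {suc l} f P P? h with gather D a feas (f ∘ suc) (P ∘ suc) (P? ∘ suc) (h ∘ suc)
  ... | U , tU , inU with P? zero
  ...   | no ¬p = U , tU , λ { zero p → contradiction p ¬p ; (suc e) p → inU e p }
  ...   | yes p with h zero p
  ...     | X , tX , inX = X ∪ᵖ U , tight-∪ D a feas tX tU ,
            λ { zero _ → ∨⁺ˡ _ inX ; (suc e) q → ∨⁺ʳ (X _) (inU e q) }

  blocked-impossible : ∀ D a → Feasible D a → ∀ i → a i ≢ t →
    ¬ (∀ e → (D ∋ e × src e ≡ a i) → ∃[ X ] (Tight D a (a i) X × X ∋ tgt e))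
  blocked-impossible D a feas i ai≢t h
    with gather D a feas tgt (λ e → D ∋ e × src e ≡ a i) (λ e → (D e Bool.≟ true) ×-dec (src e ≟ a i)) h
  ... | U , (Ut , Ui , U≤) , inU = <-irrefl refl (begin-strict
      count (out D U)    ≤⟨ U≤ ⟩
      count (U ∘ a)      <⟨ count-strict (λ j e → ∨⁺ˡ (a j == a i) e) i (∨⁺ʳ (U (a i)) (==-refl (a i))) Ui ⟩
      count (U⁺ ∘ a)     ≤⟨ feas U⁺ U⁺t ⟩
      count (out D U⁺)   ≤⟨ count-mono out⊆ ⟩
      count (out D U)    ∎)
    where
    open ≤-Reasoning
    U⁺ : Pred n
    U⁺ x = U x ∨ (x == a i)
    U⁺t : U⁺ ∌ t
    U⁺t rewrite Ut = ≢⁺ (ai≢t ∘ sym)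
    -- All arcs starting at `a i` end in `U`, so adding `a i` to `U` creates no new leaving arc.
    out⊆ : ∀ e → out D U⁺ ∋ e → out D U ∋ e
    out⊆ e o with D e in De | U (src e) in Us | U (tgt e) in Ue
    out⊆ e o  | true | true  | false = refl
    out⊆ e o  | true | true  | true  = o
    out⊆ e o  | true | false | true  = ⊥-elim (true≢false (∧⁻ʳ (src e == a i) o) refl)
    out⊆ e o  | true | false | false =
      trans (sym Ue) (inU e (De , ==⁻ (src e) (a i) (∧⁻ˡ (src e == a i) o)))

  blocked? : ∀ (D : Pred m) (a : Fin k → Fin n) i e →
    (D ∋ e × src e ≡ a i × (∀ X → ¬ (Tight D a (a i) X × X ∋ tgt e)))
    ⊎ (D ∋ e × src e ≡ a i → ∃[ X ] (Tight D a (a i) X × X ∋ tgt e))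
  blocked? D a i e with (D e Bool.≟ true) ×-dec (src e ≟ a i)
  ... | no ¬p = inj₂ λ p → contradiction p ¬p
  ... | yes (De , se) with decAll (λ X → ¬ (Tight D a (a i) X × X ∋ tgt e)) ext dec
    where
    dec : ∀ X → Dec (¬ (Tight D a (a i) X × X ∋ tgt e))
    dec X = ¬? (((X t Bool.≟ false) ×-dec ((X (a i) Bool.≟ false) ×-dec (_ ≤? _))) ×-dec (X (tgt e) Bool.≟ true))
    ext : Extensional (λ X → ¬ (Tight D a (a i) X × X ∋ tgt e))
    ext {X} {Y} eq ¬p ((Yt , Yx , le) , Ye) = ¬p ((trans (eq _) Yt , trans (eq _) Yx ,
      (begin
        count (out D X) ≡⟨ count-cong (λ e → cong₂ (λ x y → D e ∧ (x ∧ not y)) (eq _) (eq _)) ⟩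
        count (out D Y) ≤⟨ le ⟩
        count (Y ∘ a)   ≡⟨ count-cong {k} (λ j → sym (eq (a j))) ⟩
        count (X ∘ a)   ∎)) , trans (eq _) Ye)
      where open ≤-Reasoning
  ...   | inj₁ good = inj₁ (De , se , good)
  ...   | inj₂ (X , ¬¬p) = inj₂ λ _ → X ,
          decidable-stable (((X t Bool.≟ false) ×-dec ((X (a i) Bool.≟ false) ×-dec (_ ≤? _))) ×-dec (X (tgt e) Bool.≟ true)) ¬¬p

  drop : Pred m → Fin m → Pred m
  drop D e e' = D e' ∧ not (e' == e)

  -- Only sets separating the two ends of `e` are affected. If `e` leaves `X`, then `X` loses one
  -- token along with one arc. If `e` enters `X`, then `X` gains a token, and `good` provides the
  -- slack of one that this takes.
  advance : ∀ D a → Feasible D a → ∀ i e → a i ≢ t → D ∋ e → src e ≡ a i →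
    (∀ X → ¬ (Tight D a (a i) X × X ∋ tgt e)) → Feasible (drop D e) (update a i (tgt e))
  advance D a feas i e ai≢t De se good X Xt =
    cases (X (src e)) (X (tgt e)) refl refl
    where
    open ≤-Reasoning
    a' : Fin k → Fin n
    a' = update a i (tgt e)
    a≤ : ∀ {c} → X (tgt e) ≡ c → ∀ j → X (a' j) ≡ true → X (a j) ≡ true ⊎ (c ≡ true × j ≡ i)
    a≤ c j h with j ≟ i
    ... | yes refl = inj₂ (trans (sym c) h , refl)
    ... | no  j≢i  = inj₁ h
    shrink : ∀ {c d} → X (src e) ≡ c → X (tgt e) ≡ d → (c ∧ not d ≡ false) →
             count (out D X) ≤ count (out (drop D e) X)
    shrink {c} {d} p q cd = count-mono λ f o → keep f o
      where
      keep : ∀ f → out D X ∋ f → out (drop D e) X ∋ f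
      keep f o with f ≟ e
      ... | yes refl = ⊥-elim (true≢false (∧⁻ʳ (D e) o) (trans (cong₂ (λ x y → x ∧ not y) p q) cd))
      ... | no  f≢e  = ∧⁺ (∧⁺ (∧⁻ˡ (D f) o) refl) (∧⁻ʳ (D f) o)
    cases : ∀ c d → X (src e) ≡ c → X (tgt e) ≡ d → count (X ∘ a') ≤ count (out (drop D e) X)
    cases true true p q = begin
      count (X ∘ a')           ≤⟨ count-mono (λ j h → same j (a≤ q j h)) ⟩
      count (X ∘ a)            ≤⟨ feas X Xt ⟩
      count (out D X)          ≤⟨ shrink p q refl ⟩
      count (out (drop D e) X) ∎
      where
      same : ∀ j → X (a j) ≡ true ⊎ (true ≡ true × j ≡ i) → X (a j) ≡ true
      same j (inj₁ h) = h
      same j (inj₂ (_ , refl)) = trans (cong X (sym se)) p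
    cases false false p q = begin
      count (X ∘ a')           ≤⟨ count-mono (λ j h → same j (a≤ q j h)) ⟩
      count (X ∘ a)            ≤⟨ feas X Xt ⟩
      count (out D X)          ≤⟨ shrink p q refl ⟩
      count (out (drop D e) X) ∎
      where
      same : ∀ j → X (a j) ≡ true ⊎ (false ≡ true × j ≡ i) → X (a j) ≡ true
      same j (inj₁ h) = h
    cases false true p q = begin
      count (X ∘ a')                     ≤⟨ count-split (λ j h → same j (a≤ q j h)) ⟩
      count (X ∘ a) + count (_== i)      ≤⟨ +-monoʳ-≤ _ (count-== i) ⟩
      count (X ∘ a) + 1                  ≡⟨ +-comm _ 1 ⟩
      suc (count (X ∘ a))                ≤⟨ ≰⇒> (λ le → good X ((Xt , trans (cong X (sym se)) p , le) , q)) ⟩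
      count (out D X)                    ≤⟨ shrink p q refl ⟩
      count (out (drop D e) X)           ∎
      where
      same : ∀ j → X (a j) ≡ true ⊎ (true ≡ true × j ≡ i) → X (a j) ≡ true ⊎ (j == i) ≡ true
      same j (inj₁ h) = inj₁ h
      same j (inj₂ (_ , refl)) = inj₂ (==-refl i)
    cases true false p q = ≤-pred (begin
      suc (count (X ∘ a'))               ≤⟨ count-strict (λ j h → same j (a≤ q j h)) i (trans (cong X (sym se)) p)
                                             (trans (cong X (update-same a i (tgt e))) q) ⟩
      count (X ∘ a)                      ≤⟨ feas X Xt ⟩
      count (out D X)                    ≤⟨ count-split keep ⟩
      count (out (drop D e) X) + count (_== e) ≤⟨ +-monoʳ-≤ _ (count-== e) ⟩
      count (out (drop D e) X) + 1       ≡⟨ +-comm _ 1 ⟩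
      suc (count (out (drop D e) X))     ∎)
      where
      same : ∀ j → X (a j) ≡ true ⊎ (false ≡ true × j ≡ i) → X (a j) ≡ true
      same j (inj₁ h) = h
      keep : ∀ f → out D X ∋ f → out (drop D e) X ∋ f ⊎ (f == e) ≡ true
      keep f o with f ≟ e
      ... | yes _ = inj₂ refl
      ... | no  _ = inj₁ (∧⁺ (∧⁺ (∧⁻ˡ (D f) o) refl) (∧⁻ʳ (D f) o))

  extend : ∀ D a i e → D ∋ e → src e ≡ a i → Routing (drop D e) (update a i (tgt e)) → Routing D a
  extend D a i e De se (own , routes , tails) = own' , routes' , tails'
    where
    own' : Fin m → Maybe (Fin k)
    own' = update own e (just i)
    grow : ∀ j f → owned own j ∋ f → owned own' j ∋ f
    grow j f o = trans (cong (isJust= j) (update-other own e (just i) f≢e)) o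
      where
      -- The old routing uses only arcs of `drop D e`, so giving `e` to token `i` takes it from
      -- nobody.
      f≢e : f ≢ e
      f≢e refl = true≢false (==-refl e) (not⁻ (∧⁻ʳ (D e) (proj₁ (tails j f o))))
    lift : ∀ {j x y} → Star (DStep (owned own j)) x y → Star (DStep (owned own' j)) x y
    lift {j} = mapStar λ { (f , o , p) → f , grow j f o , p }
    owned-e : owned own' i ∋ e
    owned-e = trans (cong (isJust= i) (update-same own e (just i))) (==-refl i)
    routes' : ∀ j → Star (DStep (owned own' j)) (a j) t
    routes' j with j ≟ i | routes j
    ... | no  _    | r = lift r
    ... | yes refl | r = (e , owned-e , se , refl) ◅ lift r
    tails' : ∀ j f → owned own' j ∋ f → D ∋ f × Star (DStep (owned own' j)) (tgt f) t
    tails' j f o with f ≟ e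
    ... | no _ = let d , r = tails j f o in ∧⁻ˡ (D f) d , lift r
    tails' j f o | yes refl with ==⁻ j i o
    ... | refl = De , lift (subst (λ x → Star (DStep (owned own j)) x t) (update-same a i (tgt e)) (routes i))

  -- Tokens at the vertices a i walk to t: a token moves along an arc that enters no tight set,
  -- and that arc is deleted.  If all arcs leaving the token are blocked by tight sets, then the
  -- union of these sets together with the position of the token is not left by enough arcs.
  directed-menger : ∀ fuel D a → count D < fuel → Feasible D a → Routing D a
  directed-menger (suc fuel) D a (s≤s le) feas with any? (λ i → ¬? (a i ≟ t))
  ... | no  none = (λ _ → nothing) , (λ i → at-t (decidable-stable (a i ≟ t) λ ne → none (i , ne))) , λ i e ()
    where
    at-t : ∀ {x} {R : Fin n → Fin n → Set} → x ≡ t → Star R x t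
    at-t refl = ε
  ... | yes (i , ai≢t) with search (blocked? D a i)
  ...   | inj₂ h = ⊥-elim (blocked-impossible D a feas i ai≢t h)
  ...   | inj₁ (e , De , se , good) =
    extend D a i e De se (directed-menger fuel (drop D e) (update a i (tgt e)) (≤-trans (count-strict dropped e De here-gone) le) (advance D a feas i e ai≢t De se good))
    where
    dropped : ∀ f → drop D e ∋ f → D ∋ f
    dropped f = ∧⁻ˡ (D f)
    here-gone : drop D e ∌ e
    here-gone rewrite ==-refl e | De = refl

-- Undirected version: orienting the edges one after the other so that every
-- cut keeps k leaving edges reduces it to the directed one.

data Orientation : Set where
  both forward backward : Orientation

-- An edge marked `both` is not yet oriented and counts as leaving on either side. With all edges so
-- marked, `Valid` is the undirected cut condition.
leaves : Orientation → Bool → Bool → Bool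
leaves both     a b = a xor b
leaves forward  a b = a ∧ not b
leaves backward a b = b ∧ not a

module Undirected {n m} (end₁ end₂ : Fin m → Fin n) where

  cross : Pred n → Pred m
  cross X e = X (end₁ e) xor X (end₂ e)

  UStep : Pred m → Fin n → Fin n → Set
  UStep Q x y = ∃[ e ] (Q ∋ e × (end₁ e ≡ x × end₂ e ≡ y ⊎ end₁ e ≡ y × end₂ e ≡ x))

  module Orient (B : Pred m) (s t : Fin n) (k : ℕ) where

    leaving : (Fin m → Orientation) → Pred n → Pred m
    leaving o X e = B e ∧ leaves (o e) (X (end₁ e)) (X (end₂ e))

    Valid : (Fin m → Orientation) → Set
    Valid o = ∀ X → X ∋ s × X ∌ t → k ≤ count (leaving o X)

    leaving-cong : ∀ o {X Y} → (∀ i → X i ≡ Y i) → count (leaving o X) ≡ count (leaving o Y)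
    leaving-cong o eq = count-cong λ e → cong₂ (λ x y → B e ∧ leaves (o e) x y) (eq _) (eq _)

    valid? : ∀ o → Valid o ⊎ ∃[ X ] (X ∋ s × X ∌ t × count (leaving o X) < k)
    valid? o with decAll (λ X → X ∋ s × X ∌ t → k ≤ count (leaving o X)) ext dec
      where
      dec : ∀ X → Dec (X ∋ s × X ∌ t → k ≤ count (leaving o X))
      dec X = ((X s Bool.≟ true) ×-dec (X t Bool.≟ false)) →-dec (k ≤? _)
      ext : Extensional (λ X → X ∋ s × X ∌ t → k ≤ count (leaving o X))
      ext eq h (Ys , Yt) = subst (k ≤_) (leaving-cong o eq) (h (trans (eq _) Ys , trans (eq _) Yt))
    ... | inj₁ h = inj₁ h
    ... | inj₂ (X , h) with X s Bool.≟ true | X t Bool.≟ false | k ≤? count (leaving o X)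
    ...   | yes p | yes q | no  r = inj₂ (X , p , q , ≰⇒> r)
    ...   | yes p | yes q | yes r = ⊥-elim (h λ _ → r)
    ...   | no ¬p | _     | _     = ⊥-elim (h λ (p , _) → contradiction p ¬p)
    ...   | yes _ | no ¬q | _     = ⊥-elim (h λ (_ , q) → contradiction q ¬q)

    -- Changing one edge changes the count by at most one. Hence a cut that fails afterwards had
    -- exactly `k` leaving edges, one of which was `e`.
    lost : ∀ o X e d → k ≤ count (leaving o X) → count (leaving (update o e d) X) < k →
           B ∋ e × leaves (o e) (X (end₁ e)) (X (end₂ e)) ≡ true ×
           leaves d (X (end₁ e)) (X (end₂ e)) ≡ false × count (leaving o X) ≤ k
    lost o X e d ge lt =
      ∧⁻ˡ (B e) at-e , ∧⁻ʳ (B e) at-e , not-d , (begin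
        count (leaving o X)                               ≤⟨ count-split split ⟩
        count (leaving (update o e d) X) + count (_== e)  ≤⟨ +-monoʳ-≤ _ (count-== e) ⟩
        count (leaving (update o e d) X) + 1              ≡⟨ +-comm _ 1 ⟩
        suc (count (leaving (update o e d) X))            ≤⟨ lt ⟩
        k                                                 ∎)
      where
      open ≤-Reasoning
      other : ∀ f → f ≢ e → leaving (update o e d) X f ≡ leaving o X f
      other f ne = cong (λ u → B f ∧ leaves u (X (end₁ f)) (X (end₂ f))) (update-other o e d ne)
      split : ∀ f → leaving o X ∋ f → leaving (update o e d) X ∋ f ⊎ (f == e) ≡ true
      split f h with dichotomy (f == e)
      ... | inj₁ eq = inj₂ eq
      ... | inj₂ ne = inj₁ (trans (other f λ { refl → true≢false (==-refl e) ne }) h)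
      absurd : (leaving o X ∋ e → leaving (update o e d) X ∋ e) → ⊥
      absurd h = <-irrefl refl (begin-strict
        count (leaving (update o e d) X) <⟨ lt ⟩
        k                                ≤⟨ ge ⟩
        count (leaving o X)              ≤⟨ count-mono all ⟩
        count (leaving (update o e d) X) ∎)
        where
        all : ∀ f → leaving o X ∋ f → leaving (update o e d) X ∋ f
        all f g with f ≟ e
        ... | yes refl = trans (cong (λ u → B e ∧ leaves u (X (end₁ e)) (X (end₂ e))) (sym (update-same o e d))) (h' g)
          where
          h' : leaving o X ∋ e → B e ∧ leaves (update o e d e) (X (end₁ e)) (X (end₂ e)) ≡ true
          h' = h
        ... | no ne = g
      at-e : leaving o X ∋ e
      at-e with dichotomy (leaving o X e)
      ... | inj₁ h = h
      ... | inj₂ n = ⊥-elim (absurd λ h → ⊥-elim (true≢false h n))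
      not-d : leaves d (X (end₁ e)) (X (end₂ e)) ≡ false
      not-d = ¬true λ h → absurd λ g →
        trans (cong (λ u → B e ∧ leaves u (X (end₁ e)) (X (end₂ e))) (update-same o e d)) (∧⁺ (∧⁻ˡ (B e) g) h)

    uncross-bits : ∀ u a b c d →
      bit (leaves u (a ∧ c) (b ∧ d)) + bit (leaves u (a ∨ c) (b ∨ d)) ≤ bit (leaves u a b) + bit (leaves u c d)
    uncross-bits both     = pointwise₄ _ _ refl
    uncross-bits forward  = pointwise₄ _ _ refl
    uncross-bits backward = pointwise₄ _ _ refl

    -- If both orientations of e failed, e would join the difference sets of two crossing
    -- tight cuts, against submodularity.
    orientable : ∀ o e → o e ≡ both → Valid o → Valid (update o e forward) ⊎ Valid (update o e backward)
    orientable o e oe val with valid? (update o e forward) | valid? (update o e backward)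
    ... | inj₁ h | _      = inj₁ h
    ... | inj₂ _ | inj₁ h = inj₂ h
    ... | inj₂ (X , Xs , Xt , X<) | inj₂ (Y , Ys , Yt , Y<)
      with lost o X e forward (val X (Xs , Xt)) X< | lost o Y e backward (val Y (Ys , Yt)) Y<
    ...   | Be , lX , nX , X≤ | _ , lY , nY , Y≤ = ⊥-elim (<-irrefl refl (begin-strict
      k + k
        ≤⟨ +-mono-≤ (val (X ∩ᵖ Y) (∧⁺ Xs Ys , cong₂ _∧_ Xt Yt)) (val (X ∪ᵖ Y) (∨⁺ˡ _ Xs , cong₂ _∨_ Xt Yt)) ⟩
      count (leaving o (X ∩ᵖ Y)) + count (leaving o (X ∪ᵖ Y))
        <⟨ count-uncross-strict (λ f → bits f (B f)) e (gain lX nX lY nY) ⟩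
      count (leaving o X) + count (leaving o Y)
        ≤⟨ +-mono-≤ X≤ Y≤ ⟩
      k + k ∎))
      where
      open ≤-Reasoning
      bits : ∀ f β →
        bit (β ∧ leaves (o f) (X (end₁ f) ∧ Y (end₁ f)) (X (end₂ f) ∧ Y (end₂ f))) +
        bit (β ∧ leaves (o f) (X (end₁ f) ∨ Y (end₁ f)) (X (end₂ f) ∨ Y (end₂ f)))
        ≤ bit (β ∧ leaves (o f) (X (end₁ f)) (X (end₂ f))) + bit (β ∧ leaves (o f) (Y (end₁ f)) (Y (end₂ f)))
      bits f false = z≤n
      bits f true  = uncross-bits (o f) (X (end₁ f)) (X (end₂ f)) (Y (end₁ f)) (Y (end₂ f))
      gain : leaves (o e) (X (end₁ e)) (X (end₂ e)) ≡ true → leaves forward (X (end₁ e)) (X (end₂ e)) ≡ false →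
               leaves (o e) (Y (end₁ e)) (Y (end₂ e)) ≡ true → leaves backward (Y (end₁ e)) (Y (end₂ e)) ≡ false →
               bit (leaving o (X ∩ᵖ Y) e) + bit (leaving o (X ∪ᵖ Y) e) < bit (leaving o X e) + bit (leaving o Y e)
      gain p q r u rewrite oe | Be
        with X (end₁ e) | X (end₂ e) | Y (end₁ e) | Y (end₂ e) | p | q | r | u
      -- The only consistent case: `X` contains just the second end of `e` and `Y` just the first.
      -- Then `e` crosses neither the intersection nor the union, which makes the inequality strict.
      ... | false | true | true | false | _ | _ | _ | _ = s≤s z≤n
      ... | true  | true | _ | _ | () | _ | _ | _
      ... | false | false | _ | _ | () | _ | _ | _
      ... | true  | false | _ | _ | _ | () | _ | _
      ... | false | true | true | true | _ | _ | () | _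
      ... | false | true | false | false | _ | _ | () | _
      ... | false | true | false | true | _ | _ | _ | ()

    orient : ∀ (es : List (Fin m)) o → Valid o →
      ∃[ o' ] (Valid o' × (∀ e → o e ≢ both → o' e ≢ both) × (∀ e → e ∈ˡ es → o' e ≢ both))
    orient [] o val = o , val , (λ _ h → h) , λ _ ()
    orient (e ∷ es) o val = finish (step (o e) refl)
      where
      done : Orientation → Set
      done u = u ≢ both
      step : ∀ u → o e ≡ u → ∃[ o₁ ] (Valid o₁ × (∀ f → o f ≢ both → o₁ f ≢ both) × o₁ e ≢ both)
      set : ∀ d → d ≢ both → Valid (update o e d) →
            ∃[ o₁ ] (Valid o₁ × (∀ f → o f ≢ both → o₁ f ≢ both) × o₁ e ≢ both)
      set d d≢ v = update o e d , v , keep , λ eq → d≢ (trans (sym (update-same o e d)) eq)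
        where
        keep : ∀ f → o f ≢ both → update o e d f ≢ both
        keep f h with f ≟ e
        ... | yes _ = d≢
        ... | no  _ = h
      step both eq with orientable o e eq val
      ... | inj₁ v = set forward (λ ()) v
      ... | inj₂ v = set backward (λ ()) v
      step forward  eq = o , val , (λ _ h → h) , subst done (sym eq) (λ ())
      step backward eq = o , val , (λ _ h → h) , subst done (sym eq) (λ ())
      finish : ∃[ o₁ ] (Valid o₁ × (∀ f → o f ≢ both → o₁ f ≢ both) × o₁ e ≢ both) →
               ∃[ o' ] (Valid o' × (∀ f → o f ≢ both → o' f ≢ both) × (∀ f → f ∈ˡ e ∷ es → o' f ≢ both))
      finish (o₁ , v₁ , k₁ , e₁) with orient es o₁ v₁
      ... | o₂ , v₂ , k₂ , e₂ = o₂ , v₂ , (λ f h → k₂ f (k₁ f h)) ,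
            λ { f (here refl) → k₂ f e₁ ; f (there p) → e₂ f p }

    module _ (o : Fin m → Orientation) (o≢ : ∀ e → o e ≢ both) where

      src′ tgt′ : Orientation → Fin n → Fin n → Fin n
      src′ backward a b = b
      src′ _        a b = a
      tgt′ backward a b = a
      tgt′ _        a b = b

      source target : Fin m → Fin n
      source e = src′ (o e) (end₁ e) (end₂ e)
      target e = tgt′ (o e) (end₁ e) (end₂ e)

      leaves-source : ∀ (X : Pred n) u a b → u ≢ both →
        leaves u (X a) (X b) ≡ X (src′ u a b) ∧ not (X (tgt′ u a b))
      leaves-source X both     a b h = ⊥-elim (h refl)
      leaves-source X forward  a b h = refl
      leaves-source X backward a b h = refl

      joins : ∀ u (a b : Fin n) {x y} → src′ u a b ≡ x → tgt′ u a b ≡ y → (a ≡ x × b ≡ y) ⊎ (a ≡ y × b ≡ x)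
      joins both     a b p q = inj₁ (p , q)
      joins forward  a b p q = inj₁ (p , q)
      joins backward a b p q = inj₂ (q , p)

  -- All tokens start at `s`, so a set without `s` holds none and is trivially feasible. The head of
  -- an owned arc reaches `t` by the routing; the tail does so after crossing the arc itself.
  menger : ∀ (B : Pred m) (s t : Fin n) (k : ℕ) →
    (∀ X → X ∋ s → X ∌ t → k ≤ count (λ e → B e ∧ cross X e)) →
    Σ (Fin m → Maybe (Fin k)) λ own →
      (∀ i → Star (UStep (λ e → isJust= i (own e))) s t) ×
      (∀ i e → isJust= i (own e) ≡ true →
        B ∋ e × Star (UStep (λ e → isJust= i (own e))) (end₁ e) t
              × Star (UStep (λ e → isJust= i (own e))) (end₂ e) t)
  menger B s t k cut with Orient.orient B s t k (allFin m) (λ _ → both) (λ { X (p , q) → cut X p q })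
  ... | o , val , _ , all = own , (λ i → undirected i (routes i)) , spread
    where
    open Orient B s t k
    o≢ : ∀ e → o e ≢ both
    o≢ e = all e (∈-allFin e)
    module D = Directed (source o o≢) (target o o≢) t {k}
    feasible : D.Feasible B (λ _ → s)
    feasible X Xt with dichotomy (X s)
    ... | inj₂ no-s = ≤-trans (≤-reflexive (count-none {k} λ _ → no-s)) z≤n
    ... | inj₁ Xs = begin
      count {k} (λ _ → X s) ≤⟨ count-mono {k} {q = λ _ → true} (λ _ _ → refl) ⟩
      count {k} (λ _ → true) ≡⟨ count-all ⟩
      k                     ≤⟨ val X (Xs , Xt) ⟩
      count (leaving o X)   ≡⟨ count-cong (λ e → cong (B e ∧_) (leaves-source o o≢ X (o e) _ _ (o≢ e))) ⟩
      count (D.out B X)     ∎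
      where open ≤-Reasoning
    routing : D.Routing B (λ _ → s)
    routing = D.directed-menger (suc (count B)) B (λ _ → s) ≤-refl feasible
    own : Fin m → Maybe (Fin k)
    own = proj₁ routing
    routes : ∀ i → Star (D.DStep (D.owned own i)) s t
    routes = proj₁ (proj₂ routing)
    undirected : ∀ i {x y} → Star (D.DStep (D.owned own i)) x y → Star (UStep (λ e → isJust= i (own e))) x y
    undirected i = mapStar λ { (e , p , q , r) → e , p , joins o o≢ (o e) _ _ q r }
    spread : ∀ i e → isJust= i (own e) ≡ true →
        B ∋ e × Star (UStep (λ e → isJust= i (own e))) (end₁ e) t
              × Star (UStep (λ e → isJust= i (own e))) (end₂ e) t
    spread i e p with proj₂ (proj₂ routing) i e p
    ... | Be , r = Be , spread-ends (o e) (o≢ e) (undirected i r)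
      where
      S = Star (UStep (λ e → isJust= i (own e)))
      spread-ends : ∀ u → u ≢ both → S (tgt′ o o≢ u (end₁ e) (end₂ e)) t → S (end₁ e) t × S (end₂ e) t
      spread-ends both     h _ = ⊥-elim (h refl)
      spread-ends forward  _ r = (e , p , inj₁ (refl , refl)) ◅ r , r
      spread-ends backward _ r = r , (e , p , inj₂ (refl , refl)) ◅ r

-- Tight sets and minimal edge sets

module Network {n m} (end₁ end₂ : Fin m → Fin n) (v : Fin n) (S : Pred n) (k : ℕ) where

  open Undirected end₁ end₂ public

  Ends : Fin m → Fin n → Fin n → Set
  Ends e x y = end₁ e ≡ x × end₂ e ≡ y ⊎ end₁ e ≡ y × end₂ e ≡ x

  cross⁻ : ∀ X e → cross X e ≡ true → ∃[ x ] ∃[ y ] (Ends e x y × X ∋ x × X ∌ y)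
  cross⁻ X e h with X (end₁ e) in p | X (end₂ e) in q
  ... | true  | false = _ , _ , inj₁ (refl , refl) , p , q
  ... | false | true  = _ , _ , inj₂ (refl , refl) , q , p

  cross⁺ : ∀ X {e x y} → Ends e x y → X ∋ x → X ∌ y → cross X e ≡ true
  cross⁺ X (inj₁ (refl , refl)) p q rewrite p | q = refl
  cross⁺ X (inj₂ (refl , refl)) p q rewrite p | q = refl

  cut : Pred m → Pred n → Pred m
  cut A X e = A e ∧ cross X e

  cut-cong : ∀ A {X Y} → (∀ i → X i ≡ Y i) → count (cut A X) ≡ count (cut A Y)
  cut-cong A eq = count-cong λ e → cong (A e ∧_) (cong₂ _xor_ (eq _) (eq _))

  cut-uncross : ∀ A (f g : Bool → Bool → Bool) →
    (∀ a b c d → bit (f a c xor f b d) + bit (g a c xor g b d) ≤ bit (a xor b) + bit (c xor d)) →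
    ∀ X Y → count (cut A λ x → f (X x) (Y x)) + count (cut A λ x → g (X x) (Y x))
            ≤ count (cut A X) + count (cut A Y)
  cut-uncross A f g bits X Y = count-uncross λ e → at (A e) (X (end₁ e)) (X (end₂ e)) (Y (end₁ e)) (Y (end₂ e))
    where
    at : ∀ α a b c d → bit (α ∧ (f a c xor f b d)) + bit (α ∧ (g a c xor g b d))
                       ≤ bit (α ∧ (a xor b)) + bit (α ∧ (c xor d))
    at false a b c d = z≤n
    at true  a b c d = bits a b c d

  submodular : ∀ A X Y → count (cut A (X ∩ᵖ Y)) + count (cut A (X ∪ᵖ Y)) ≤ count (cut A X) + count (cut A Y)
  submodular A = cut-uncross A _∧_ _∨_ (pointwise₄ _ _ refl)

  posimodular : ∀ A X Y → count (cut A (X ∖ᵖ Y)) + count (cut A (Y ∖ᵖ X)) ≤ count (cut A X) + count (cut A Y)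
  posimodular A = cut-uncross A (λ x y → x ∧ not y) (λ x y → y ∧ not x) (pointwise₄ _ _ refl)

  Connects : Pred m → Set
  Connects A = ∀ s → S ∋ s → (∃[ e ] (A ∋ e × Ends e v s)) ×
                             (∀ X → X ∋ s → X ∌ v → k ≤ count (cut A X))

  Tight : Pred m → Pred n → Set
  Tight A X = (∃[ s ] (S ∋ s × X ∋ s)) × X ∌ v × count (cut A X) ≤ k

  Needed : Pred m → Fin m → Set
  Needed A e = (∃[ X ] (Tight A X × cross X e ≡ true))
             ⊎ (∃[ s ] (S ∋ s × Ends e v s × (∀ f → A ∋ f → Ends f v s → f ≡ e)))

  -- Deleting further edges never makes a kept edge deletable, so `prune` gets by with a single
  -- pass.
  needed-mono : ∀ {A A' e} → (∀ f → A' ∋ f → A ∋ f) → Needed A e → Needed A' e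
  needed-mono {A} {A'} sub (inj₁ (X , (s , Xv , le) , c)) =
    inj₁ (X , (s , Xv , ≤-trans (count-mono smaller) le) , c)
    where
    smaller : ∀ f → cut A' X ∋ f → cut A X ∋ f
    smaller f h = ∧⁺ (sub f (∧⁻ˡ (A' f) h)) (∧⁻ʳ (A' f) h)
  needed-mono sub (inj₂ (s , Ss , es , u)) = inj₂ (s , Ss , es , λ f Af → u f (sub f Af))

  ends? : ∀ e x y → Dec (Ends e x y)
  ends? e x y = ((end₁ e ≟ x) ×-dec (end₂ e ≟ y)) ⊎-dec ((end₁ e ≟ y) ×-dec (end₂ e ≟ x))

  remove : Pred m → Fin m → Pred m
  remove A e f = A f ∧ not (f == e)

  remove⁺ : ∀ A {e f} → A ∋ f → f ≢ e → remove A e ∋ f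
  remove⁺ A Af ne = ∧⁺ Af (not⁺ (≢⁺ ne))

  remove-cut : ∀ A e X → count (cut A X) ≤ suc (count (cut (remove A e) X))
  remove-cut A e X = begin
    count (cut A X)                                ≤⟨ count-split split ⟩
    count (cut (remove A e) X) + count (_== e)     ≤⟨ +-monoʳ-≤ _ (count-== e) ⟩
    count (cut (remove A e) X) + 1                 ≡⟨ +-comm _ 1 ⟩
    suc (count (cut (remove A e) X))               ∎
    where
    open ≤-Reasoning
    split : ∀ f → cut A X ∋ f → cut (remove A e) X ∋ f ⊎ (f == e) ≡ true
    split f h with f ≟ e
    ... | yes _ = inj₂ refl
    ... | no  _ = inj₁ (∧⁺ (∧⁺ (∧⁻ˡ (A f) h) refl) (∧⁻ʳ (A f) h))

  -- Deletion fails for one of two reasons. Either `e` was the last edge from `v` to some `s`, or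
  -- some cut falls below `k`; one more edge makes at most `k`, so that set was tight already and
  -- `e` crosses it.
  needed? : ∀ A e → Connects A → Connects (remove A e) ⊎ Needed A e
  needed? A e conn with search at
    where
    at : ∀ s → Needed A e ⊎ (S ∋ s → (∃[ f ] (remove A e ∋ f × Ends f v s)) ×
                                      (∀ X → X ∋ s → X ∌ v → k ≤ count (cut (remove A e) X)))
    at s with dichotomy (S s)
    ... | inj₂ no-s = inj₂ λ Ss → ⊥-elim (true≢false Ss no-s)
    ... | inj₁ Ss with any? (λ f → (remove A e f Bool.≟ true) ×-dec ends? f v s)
    ...   | no none = inj₁ (inj₂ (s , Ss , subst (λ f → Ends f v s) (only f Af Ef) Ef , only))
      where
      only : ∀ f → A ∋ f → Ends f v s → f ≡ e
      only f Af Ef = decidable-stable (f ≟ e) λ ne → none (f , remove⁺ A Af ne , Ef)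
      f = proj₁ (proj₁ (conn s Ss))
      Af = proj₁ (proj₂ (proj₁ (conn s Ss)))
      Ef = proj₂ (proj₂ (proj₁ (conn s Ss)))
    ...   | yes edge with decAll (λ X → X ∋ s × X ∌ v → k ≤ count (cut (remove A e) X)) ext dec
      where
      dec : ∀ X → Dec (X ∋ s × X ∌ v → k ≤ count (cut (remove A e) X))
      dec X = ((X s Bool.≟ true) ×-dec (X v Bool.≟ false)) →-dec (k ≤? _)
      ext : Extensional (λ X → X ∋ s × X ∌ v → k ≤ count (cut (remove A e) X))
      ext eq h (p , q) = subst (k ≤_) (cut-cong (remove A e) eq) (h (trans (eq _) p , trans (eq _) q))
    ...     | inj₁ h = inj₂ λ _ → edge , λ X p q → h X (p , q)
    ...     | inj₂ (X , h) with X s Bool.≟ true | X v Bool.≟ false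
    ...       | no ¬p | _     = ⊥-elim (h λ (p , _) → contradiction p ¬p)
    ...       | yes _ | no ¬q = ⊥-elim (h λ (_ , q) → contradiction q ¬q)
    ...       | yes p | yes q = inj₁ (inj₁ (X , ((s , Ss , p) , q , ≤-trans (remove-cut A e X) small) , crosses))
      where
      small : count (cut (remove A e) X) < k
      small = ≰⇒> λ le → h λ _ → le
      crosses : cross X e ≡ true
      crosses with dichotomy (cross X e)
      ... | inj₁ c = c
      ... | inj₂ c = ⊥-elim (h λ _ → ≤-trans (proj₂ (conn s Ss) X p q) (count-mono keep))
        where
        keep : ∀ f → cut A X ∋ f → cut (remove A e) X ∋ f
        keep f g = ∧⁺ (remove⁺ A (∧⁻ˡ (A f) g) λ { refl → true≢false (∧⁻ʳ (A f) g) c }) (∧⁻ʳ (A f) g)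
  ... | inj₁ (_ , need) = inj₂ need
  ... | inj₂ all = inj₁ all

  prune : ∀ (es : List (Fin m)) A → Connects A →
    ∃[ A' ] (Connects A' × (∀ e → A' ∋ e → A ∋ e) × (∀ e → e ∈ˡ es → A' ∋ e → Needed A' e))
  prune [] A conn = A , conn , (λ _ h → h) , λ _ ()
  prune (e ∷ es) A conn with needed? A e conn
  ... | inj₁ conn' with prune es (remove A e) conn'
  ...   | A' , c , sub , need = A' , c , (λ f h → ∧⁻ˡ (A f) (sub f h)) , λ where
            f (here refl) h → ⊥-elim (true≢false (==-refl e) (not⁻ (∧⁻ʳ (A e) (sub e h))))
            f (there p)   h → need f p h
  prune (e ∷ es) A conn | inj₂ ne with prune es A conn
  ...   | A' , c , sub , need = A' , c , sub , λ where
            f (here refl) h → needed-mono sub ne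
            f (there p)   h → need f p h

  minimal : ∀ A → Connects A → ∃[ A' ] (Connects A' × (∀ e → A' ∋ e → Needed A' e))
  minimal A conn with prune (allFin m) A conn
  ... | A' , c , _ , need = A' , c , λ e → need e (∈-allFin e)

  -- Cells

  -- The sets themselves are altered by uncrossing, but their union `covered` is kept exactly. An
  -- edge that crossed one of the original sets has an end in the union and hence in a cell.
  record Family (A : Pred m) (covered : Fin n → Set) : Set where
    field
      size     : ℕ
      cell     : Fin size → Pred n
      tight    : ∀ i → Tight A (cell i)
      disjoint : ∀ {i j x} → cell i ∋ x → cell j ∋ x → i ≡ j
      into     : ∀ i {x} → cell i ∋ x → covered x
      onto     : ∀ {x} → covered x → ∃[ i ] cell i ∋ x

  tight-cut : ∀ {A X} → Connects A → (∃[ s ] (S ∋ s × X ∋ s)) → X ∌ v → k ≤ count (cut A X)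
  tight-cut conn (s , Ss , Xs) Xv = proj₂ (conn s Ss) _ Xs Xv

  -- The intersection meets `S`, so it already uses `k` of the at most `2k` edges that submodularity
  -- allows.
  tight-union : ∀ {A X Y} → Connects A → Tight A X → Tight A Y →
    (∃[ s ] (S ∋ s × (X ∩ᵖ Y) ∋ s)) → Tight A (X ∪ᵖ Y)
  tight-union {A} {X} {Y} conn ((s , Ss , Xs) , Xv , X≤) (_ , Yv , Y≤) meet =
    (s , Ss , ∨⁺ˡ _ Xs) , cong₂ _∨_ Xv Yv , +-cancelˡ-≤ k _ _ (begin
      k + count (cut A (X ∪ᵖ Y))
        ≤⟨ +-monoˡ-≤ _ (tight-cut {X = X ∩ᵖ Y} conn meet (cong₂ _∧_ Xv Yv)) ⟩
      count (cut A (X ∩ᵖ Y)) + count (cut A (X ∪ᵖ Y)) ≤⟨ submodular A X Y ⟩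
      count (cut A X) + count (cut A Y)               ≤⟨ +-mono-≤ X≤ Y≤ ⟩
      k + k                                           ∎)
    where open ≤-Reasoning

  -- As the intersection misses `S`, each difference keeps its vertices of `S`. Posimodularity then
  -- plays the role of submodularity, with `k` edges taken by the other difference.
  tight-minus : ∀ {A X Y} → Connects A → Tight A X → Tight A Y →
    (∀ s → S ∋ s → X ∋ s → Y ∌ s) → Tight A (X ∖ᵖ Y)
  tight-minus {A} {X} {Y} conn ((s , Ss , Xs) , Xv , X≤) ((r , Sr , Yr) , Yv , Y≤) apart =
    (s , Ss , ∧⁺ Xs (not⁺ (apart s Ss Xs))) , cong (_∧ _) Xv , +-cancelʳ-≤ k _ _ (begin
      count (cut A (X ∖ᵖ Y)) + k
        ≤⟨ +-monoʳ-≤ _ (tight-cut {X = Y ∖ᵖ X} conn (r , Sr , ∧⁺ Yr (not⁺ Xr)) (cong (_∧ _) Yv)) ⟩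
      count (cut A (X ∖ᵖ Y)) + count (cut A (Y ∖ᵖ X)) ≤⟨ posimodular A X Y ⟩
      count (cut A X) + count (cut A Y)               ≤⟨ +-mono-≤ X≤ Y≤ ⟩
      k + k                                           ∎)
    where
    open ≤-Reasoning
    Xr : X ∌ r
    Xr = ¬true λ h → true≢false Yr (apart r Sr h)

  -- The new set absorbs the first cell if they share a vertex of `S`, and otherwise cedes the
  -- overlap to it. Either way the union is unchanged and one cell fewer remains to be compared.
  insert : ∀ {A} → Connects A → ∀ size (cell : Fin size → Pred n) X →
    (∀ i → Tight A (cell i)) → (∀ {i j x} → cell i ∋ x → cell j ∋ x → i ≡ j) → Tight A X →
    Family A (λ x → X ∋ x ⊎ ∃[ i ] cell i ∋ x)
  insert conn zero cell X tights disj tX = record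
    { size = 1 ; cell = λ _ → X ; tight = λ _ → tX ; disjoint = λ { {zero} {zero} _ _ → refl }
    ; into = λ _ → inj₁ ; onto = λ { (inj₁ h) → zero , h } }
  insert {A} conn (suc c) cell X tights disj tX with any? (λ s → (S s Bool.≟ true) ×-dec ((X ∩ᵖ cell zero) s Bool.≟ true))
  ... | yes meet = record
    { size = Fam.size ; cell = Fam.cell ; tight = Fam.tight ; disjoint = Fam.disjoint
    ; into = λ i h → out (Fam.into i h) ; onto = λ h → Fam.onto (back h) }
    where
    X' = X ∪ᵖ cell zero
    module Fam = Family (insert conn c (cell ∘ suc) X' (tights ∘ suc)
      (λ p q → suc-injective (disj p q)) (tight-union conn tX (tights zero) meet))
    out : ∀ {x} → X' ∋ x ⊎ ∃[ i ] cell (suc i) ∋ x → X ∋ x ⊎ ∃[ i ] cell i ∋ x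
    out {x} (inj₁ h) with ∨⁻ (X x) h
    ... | inj₁ p = inj₁ p
    ... | inj₂ q = inj₂ (zero , q)
    out (inj₂ (i , h)) = inj₂ (suc i , h)
    back : ∀ {x} → X ∋ x ⊎ ∃[ i ] cell i ∋ x → X' ∋ x ⊎ ∃[ i ] cell (suc i) ∋ x
    back (inj₁ h)           = inj₁ (∨⁺ˡ _ h)
    back {x} (inj₂ (zero , h))  = inj₁ (∨⁺ʳ (X x) h)
    back (inj₂ (suc i , h)) = inj₂ (i , h)
  ... | no apart = record
    { size = suc Fam.size ; cell = cell zero ◂ Fam.cell
    ; tight = λ { zero → tights zero ; (suc i) → Fam.tight i }
    ; disjoint = disj'
    ; into = λ { zero h → inj₂ (zero , h) ; (suc i) h → out (Fam.into i h) }
    ; onto = back }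
    where
    X' = X ∖ᵖ cell zero
    module Fam = Family (insert conn c (cell ∘ suc) X' (tights ∘ suc)
      (λ p q → suc-injective (disj p q))
      (tight-minus conn tX (tights zero) λ s Ss Xs → ¬true λ h → apart (s , Ss , ∧⁺ Xs h)))
    out : ∀ {x} → X' ∋ x ⊎ ∃[ i ] cell (suc i) ∋ x → X ∋ x ⊎ ∃[ i ] cell i ∋ x
    out {x} (inj₁ h) = inj₁ (∧⁻ˡ (X x) h)
    out (inj₂ (i , h)) = inj₂ (suc i , h)
    separate : ∀ {x} → cell zero ∋ x → X' ∋ x ⊎ ∃[ i ] cell (suc i) ∋ x → ⊥
    separate {x} h (inj₁ g) = true≢false h (not⁻ (∧⁻ʳ (X x) g))
    separate h (inj₂ (i , g)) with disj h g
    ... | ()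
    disj' : ∀ {i j x} → (cell zero ◂ Fam.cell) i ∋ x → (cell zero ◂ Fam.cell) j ∋ x → i ≡ j
    disj' {zero}  {zero}  p q = refl
    disj' {zero}  {suc j} p q = ⊥-elim (separate p (Fam.into j q))
    disj' {suc i} {zero}  p q = ⊥-elim (separate q (Fam.into i p))
    disj' {suc i} {suc j} p q = cong suc (Fam.disjoint p q)
    back : ∀ {x} → X ∋ x ⊎ ∃[ i ] cell i ∋ x → ∃[ i ] (cell zero ◂ Fam.cell) i ∋ x
    back {x} (inj₁ h) with dichotomy (cell zero x)
    ... | inj₁ p = zero , p
    ... | inj₂ q = let i , r = Fam.onto (inj₁ (∧⁺ h (not⁺ q))) in suc i , r
    back (inj₂ (zero , h))  = zero , h
    back (inj₂ (suc i , h)) = let j , r = Fam.onto (inj₂ (i , h)) in suc j , r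

  uncrossed : ∀ {A} → Connects A → ∀ {l} (X : Fin l → Pred n) (P : Fin l → Set) → (∀ i → Dec (P i)) →
    (∀ i → P i → Tight A (X i)) → Family A (λ x → ∃[ i ] (P i × X i ∋ x))
  uncrossed conn {zero} X P P? h = record
    { size = 0 ; cell = λ () ; tight = λ () ; disjoint = λ { {()} } ; into = λ () ; onto = λ { (() , _) } }
  uncrossed {A} conn {suc l} X P P? h with uncrossed conn (X ∘ suc) (P ∘ suc) (P? ∘ suc) (h ∘ suc) | P? zero
  ... | F | no ¬p = record
    { size = F.size ; cell = F.cell ; tight = F.tight ; disjoint = F.disjoint
    ; into = λ i g → let j , p = F.into i g in suc j , p
    ; onto = λ { (zero , p , _) → contradiction p ¬p ; (suc j , p) → F.onto (j , p) } }
    where module F = Family F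
  ... | F | yes p = record
    { size = F'.size ; cell = F'.cell ; tight = F'.tight ; disjoint = F'.disjoint
    ; into = λ i g → out (F'.into i g)
    ; onto = λ { (zero , _ , q) → F'.onto (inj₁ q) ; (suc j , q) → F'.onto (inj₂ (F.onto (j , q))) } }
    where
    module F = Family F
    module F' = Family (insert conn F.size F.cell (X zero) F.tight F.disjoint (h zero p))
    out : ∀ {x} → X zero ∋ x ⊎ ∃[ i ] F.cell i ∋ x → ∃[ i ] (P i × X i ∋ x)
    out (inj₁ g) = zero , p , g
    out (inj₂ (i , g)) = let j , q = F.into i g in suc j , q

  record Cells : Set where
    field
      A        : Pred m
      #C       : ℕ
      cell     : Fin #C → Pred n
      root     : Fin #C → Fin n
      disjoint : ∀ {i j x} → cell i ∋ x → cell j ∋ x → i ≡ j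
      root∈S   : ∀ i → S ∋ root i
      root∈    : ∀ i → cell i ∋ root i
      v∉       : ∀ i → cell i ∌ v
      small    : ∀ i → count (cut A (cell i)) ≤ k
      toV      : ∀ s → S ∋ s → ∃[ e ] (A ∋ e × Ends e v s)
      cuts     : ∀ s X → S ∋ s → X ∋ s → X ∌ v → k ≤ count (cut A X)
      touched  : ∀ e → A ∋ e → (∃[ i ] (cell i ∋ end₁ e ⊎ cell i ∋ end₂ e))
                 ⊎ (∃[ s ] (S ∋ s × Ends e v s × (∀ f → A ∋ f → Ends f v s → f ≡ e)))

  cells : ∀ A → Connects A → Cells
  cells A₀ conn₀ with minimal A₀ conn₀
  ... | A , conn , need = record
    { A = A ; #C = F.size ; cell = F.cell ; root = λ i → proj₁ (proj₁ (F.tight i))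
    ; disjoint = F.disjoint ; root∈S = λ i → proj₁ (proj₂ (proj₁ (F.tight i)))
    ; root∈ = λ i → proj₂ (proj₂ (proj₁ (F.tight i)))
    ; v∉ = λ i → proj₁ (proj₂ (F.tight i)) ; small = λ i → proj₂ (proj₂ (F.tight i))
    ; toV = λ s Ss → proj₁ (conn s Ss) ; cuts = λ s X Ss → proj₂ (conn s Ss) X
    ; touched = touched }
    where
    -- The flag tells whether `e` comes with a tight set. Absent edges, and edges needed only as the
    -- last link to a neighbour of `v`, carry the empty set as a dummy, which the family skips.
    blocker : ∀ e → Dec (A ∋ e) → Pred n × Bool
    blocker e (no _)  = (λ _ → false) , false
    blocker e (yes h) with need e h
    ... | inj₁ (X , _) = X , true
    ... | inj₂ _       = (λ _ → false) , false
    A? : ∀ e → Dec (A ∋ e)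
    A? e = A e Bool.≟ true
    tight : ∀ e a → proj₂ (blocker e a) ≡ true → Tight A (proj₁ (blocker e a))
    tight e (yes h) eq with need e h
    ... | inj₁ (X , t , _) = t
    module F = Family (uncrossed conn (λ e → proj₁ (blocker e (A? e))) (λ e → proj₂ (blocker e (A? e)) ≡ true)
                        (λ e → proj₂ (blocker e (A? e)) Bool.≟ true) (λ e → tight e (A? e)))
    touched : ∀ e → A ∋ e → (∃[ i ] (F.cell i ∋ end₁ e ⊎ F.cell i ∋ end₂ e))
                 ⊎ (∃[ s ] (S ∋ s × Ends e v s × (∀ f → A ∋ f → Ends f v s → f ≡ e)))
    touched e h = by (A? e) (λ x p q → F.onto (e , p , q))
      where
      by : ∀ a → (∀ x → proj₂ (blocker e a) ≡ true → proj₁ (blocker e a) ∋ x → ∃[ i ] F.cell i ∋ x) →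
           (∃[ i ] (F.cell i ∋ end₁ e ⊎ F.cell i ∋ end₂ e))
           ⊎ (∃[ s ] (S ∋ s × Ends e v s × (∀ f → A ∋ f → Ends f v s → f ≡ e)))
      by (no ¬h) _ = contradiction h ¬h
      by (yes h) on with need e h
      ... | inj₂ u = inj₂ u
      ... | inj₁ (X , t , c) with X (end₁ e) in p | X (end₂ e) in q
      ...   | true  | _    = let i , r = on _ refl p in inj₁ (i , inj₁ r)
      ...   | false | true = let i , r = on _ refl q in inj₁ (i , inj₂ r)

-- Applied to the edges at a hub: the upper bound keeps the number of adjacent cells bounded, and
-- a class of K edges cannot end in few cells only.
chunk : ∀ {m} K → 1 ≤ K → ∀ fuel (P : Pred m) → count P ≤ fuel →
  Σ (Fin m → ℕ) λ lab → ∀ e → P ∋ e →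
    count (λ f → P f ∧ does (lab f ℕ.≟ lab e)) ≤ 2 * K ×
    (K ≤ count (λ f → P f ∧ does (lab f ℕ.≟ lab e)) ⊎ (∀ f → P ∋ f → lab f ≡ lab e))
chunk {m} K K≥1 fuel P le with count P ≤? 2 * K
... | yes few = (λ _ → 0) , λ e _ → ≤-trans (count-mono λ f → ∧⁻ˡ (P f)) few , inj₂ λ _ _ → refl
... | no many with fuel
...   | zero = ⊥-elim (many (≤-trans le z≤n))
...   | suc fuel' with subset-of-size P K K≤P
  where
  K≤P : K ≤ count P
  K≤P = ≤-trans (m≤m+n K _) (<⇒≤ (≰⇒> many))
...     | Q , Q⊆P , Q≡K with chunk K K≥1 fuel' (λ f → P f ∧ not (Q f)) rest≤
  where
  rest≤ : count (λ f → P f ∧ not (Q f)) ≤ fuel'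
  rest≤ = ≤-pred (begin
    suc (count (λ f → P f ∧ not (Q f)))      ≤⟨ +-monoˡ-≤ _ K≥1 ⟩
    K + count (λ f → P f ∧ not (Q f))        ≡⟨ cong (_+ _) (sym Q≡K) ⟩
    count Q + count (λ f → P f ∧ not (Q f))  ≡⟨ sym (count-minus Q⊆P) ⟩
    count P                                  ≤⟨ le ⟩
    suc fuel'                                ∎)
    where open ≤-Reasoning
...       | lab' , IH = lab , classes
  where
  open ≤-Reasoning
  P' : Pred m
  P' f = P f ∧ not (Q f)
  K≤P' : K ≤ count P'
  K≤P' = +-cancelˡ-≤ K _ _ (begin
    K + K                ≡⟨ cong (K +_) (sym (+-identityʳ K)) ⟩
    2 * K                ≤⟨ <⇒≤ (≰⇒> many) ⟩
    count P              ≡⟨ count-minus Q⊆P ⟩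
    count Q + count P'   ≡⟨ cong (_+ count P') Q≡K ⟩
    K + count P'         ∎)
  lab : Fin m → ℕ
  lab f = if Q f then 0 else suc (lab' f)
  class-Q : ∀ e → Q ∋ e → count (λ f → P f ∧ does (lab f ℕ.≟ lab e)) ≡ K
  class-Q e Qe = trans (count-cong same) Q≡K
    where
    same : ∀ f → P f ∧ does (lab f ℕ.≟ lab e) ≡ Q f
    same f rewrite Qe with Q f in Qf
    ... | true rewrite Q⊆P f Qf = refl
    ... | false with P f
    ...   | true  = refl
    ...   | false = refl
  class-P' : ∀ e → Q ∌ e → count (λ f → P f ∧ does (lab f ℕ.≟ lab e)) ≡ count (λ f → P' f ∧ does (lab' f ℕ.≟ lab' e))
  class-P' e Qe = count-cong same
    where
    same : ∀ f → P f ∧ does (lab f ℕ.≟ lab e) ≡ P' f ∧ does (lab' f ℕ.≟ lab' e)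
    same f rewrite Qe with Q f | P f
    ... | true  | true  = refl
    ... | true  | false = refl
    ... | false | true  = refl
    ... | false | false = refl
  classes : ∀ e → P ∋ e →
    count (λ f → P f ∧ does (lab f ℕ.≟ lab e)) ≤ 2 * K ×
    (K ≤ count (λ f → P f ∧ does (lab f ℕ.≟ lab e)) ⊎ (∀ f → P ∋ f → lab f ≡ lab e))
  classes e Pe with dichotomy (Q e)
  ... | inj₁ Qe rewrite class-Q e Qe = m≤m+n K _ , inj₁ ≤-refl
  ... | inj₂ Qe rewrite class-P' e Qe with IH e (∧⁺ Pe (not⁺ Qe))
  ...   | ub , inj₁ lb = ub , inj₁ lb
  -- If the remainder is one class, it has at least `K` edges, since `Q` took `K` out of more than
  -- `2 * K`. The exceptional alternative thus survives only when all of `P` is small.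
  ...   | ub , inj₂ all = ub , inj₁ (≤-trans K≤P' (count-mono λ f P'f → ∧⁺ P'f (dec-true (lab' f ℕ.≟ lab' e) (all f P'f))))

-- Regions around cells and their cuts

module Regions {n m} (end₁ end₂ : Fin m → Fin n) (v : Fin n) (S : Pred n) (ρ : ℕ)
  (C : Network.Cells end₁ end₂ v S (suc ρ)) where

  open Network end₁ end₂ v S (suc ρ)
  open Cells C

  -- Chosen so that `ρ` cells with at most `suc ρ` boundary edges each leave at least `suc ρ` edges
  -- of a class of size `K` unaccounted for.
  K : ℕ
  K = suc ρ * suc ρ

  Hub : Fin n → Set
  Hub x = (∀ i → cell i ∌ x) × x ≢ v

  hub? : ∀ x → Dec (Hub x)
  hub? x = all? (λ i → cell i x Bool.≟ false) ×-dec ¬? (x ≟ v)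

  classify : ∀ x → (∃[ i ] cell i ∋ x) ⊎ (x ≡ v) ⊎ Hub x
  classify x with any? (λ i → cell i x Bool.≟ true) | x ≟ v
  ... | yes c   | _     = inj₁ c
  ... | no _    | yes p = inj₂ (inj₁ p)
  ... | no none | no ne = inj₂ (inj₂ ((λ i → ¬true λ h → none (i , h)) , ne))

  star : Fin n → Pred m
  star h e = A e ∧ ((end₁ e == h) ∨ (end₂ e == h))

  star⁻ : ∀ {h e} → star h ∋ e → A ∋ e × ∃[ y ] Ends e h y
  star⁻ {h} {e} p with ∨⁻ (end₁ e == h) (∧⁻ʳ (A e) p)
  ... | inj₁ q = ∧⁻ˡ (A e) p , _ , inj₁ (==⁻ _ h q , refl)
  ... | inj₂ q = ∧⁻ˡ (A e) p , _ , inj₂ (refl , ==⁻ _ h q)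

  star⁺ : ∀ {h e y} → A ∋ e → Ends e h y → star h ∋ e
  star⁺ {h} {e} Ae (inj₁ (refl , _)) = ∧⁺ Ae (∨⁺ˡ _ (==-refl (end₁ e)))
  star⁺ {h} {e} Ae (inj₂ (_ , refl)) = ∧⁺ Ae (∨⁺ʳ (end₁ e == end₂ e) (==-refl (end₂ e)))

  labelling : ∀ h → _
  labelling h = chunk K (s≤s z≤n) (count (star h)) (star h) ≤-refl

  lab : Fin n → Fin m → ℕ
  lab h = proj₁ (labelling h)

  class : Fin n → Fin m → Pred m
  class h f g = star h g ∧ does (lab h g ℕ.≟ lab h f)

  class⁺ : ∀ {h f g} → star h ∋ g → lab h g ≡ lab h f → class h f ∋ g
  class⁺ {h} {f} {g} s l = ∧⁺ s (dec-true (lab h g ℕ.≟ lab h f) l)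

  class⁻ : ∀ {h f g} → class h f ∋ g → star h ∋ g × lab h g ≡ lab h f
  class⁻ {h} {f} {g} c = ∧⁻ˡ (star h g) c , does⁻ (lab h g ℕ.≟ lab h f) (∧⁻ʳ (star h g) c)

  Near : Fin m → Fin m → Set
  Near f g = f ≡ g ⊎ ∃[ h ] (Hub h × star h ∋ f × class h f ∋ g)

  near? : ∀ f g → Dec (Near f g)
  near? f g = (f ≟ g) ⊎-dec any? λ h → hub? h ×-dec ((star h f Bool.≟ true) ×-dec (class h f g Bool.≟ true))

  near-sym : ∀ {f g} → Near f g → Near g f
  near-sym (inj₁ eq) = inj₁ (sym eq)
  near-sym {f} {g} (inj₂ (h , hub , s , c)) = let sg , l = class⁻ {h} {f} {g} c in
    inj₂ (h , hub , sg , class⁺ {h} {g} {f} s (sym l))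

  near-A : ∀ {f g} → A ∋ f → Near f g → A ∋ g
  near-A Af (inj₁ refl) = Af
  near-A {f} {g} Af (inj₂ (h , _ , _ , c)) = proj₁ (star⁻ {h} {g} (proj₁ (class⁻ {h} {f} {g} c)))

  boundary : Fin #C → Pred m
  boundary i = cut A (cell i)

  boundary⁻ : ∀ {i e} → boundary i ∋ e → A ∋ e × ∃[ x ] ∃[ y ] (Ends e x y × cell i ∋ x × cell i ∌ y)
  boundary⁻ {i} {e} b = ∧⁻ˡ (A e) b , cross⁻ (cell i) e (∧⁻ʳ (A e) b)

  boundary⁺ : ∀ {i e x y} → A ∋ e → Ends e x y → cell i ∋ x → cell i ∌ y → boundary i ∋ e
  boundary⁺ {i} {e} Ae E p q = ∧⁺ Ae (cross⁺ (cell i) {e} E p q)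

  Adj : Fin #C → Fin #C → Set
  Adj i j = i ≡ j ⊎ ∃[ f ] ∃[ g ] (boundary i ∋ f × Near f g × boundary j ∋ g)

  adj? : ∀ i j → Dec (Adj i j)
  adj? i j = (i ≟ j) ⊎-dec any? λ f → any? λ g →
    (boundary i f Bool.≟ true) ×-dec (near? f g ×-dec (boundary j g Bool.≟ true))

  adj-sym : ∀ {i j} → Adj i j → Adj j i
  adj-sym (inj₁ eq) = inj₁ (sym eq)
  adj-sym (inj₂ (f , g , p , q , r)) = inj₂ (g , f , r , near-sym q , p)

  -- Since `Adj` is reflexive, `Reach r` means distance at most `r`.
  Reach : ℕ → Fin #C → Fin #C → Set
  Reach zero    i j = i ≡ j
  Reach (suc r) i j = ∃[ l ] (Reach r i l × Adj l j)

  reach? : ∀ r i j → Dec (Reach r i j)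
  reach? zero    i j = i ≟ j
  reach? (suc r) i j = any? λ l → reach? r i l ×-dec adj? l j

  reach-mono : ∀ {r s i j} → r ≤ s → Reach r i j → Reach s i j
  reach-mono {s = zero}  z≤n p = p
  reach-mono {s = suc s} z≤n p = _ , reach-mono {s = s} z≤n p , inj₁ refl
  reach-mono (s≤s le) (l , p , q) = l , reach-mono le p , q

  Inside : Fin #C → Fin m → Set
  Inside j g = cell j ∋ end₁ g × cell j ∋ end₂ g

  inside⁺ : ∀ {j g x y} → Ends g x y → cell j ∋ x → cell j ∋ y → Inside j g
  inside⁺ (inj₁ (refl , refl)) p q = p , q
  inside⁺ (inj₂ (refl , refl)) p q = q , p

  -- The whole class of a boundary edge is included, wherever its edges lead. The crossing edges
  -- obtained from a large class therefore lie in the region.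
  Around : Fin #C → Fin m → Set
  Around j g = A ∋ g × (Inside j g ⊎ ∃[ f ] (boundary j ∋ f × Near f g))

  around? : ∀ j g → Dec (Around j g)
  around? j g = (A g Bool.≟ true) ×-dec
    (((cell j (end₁ g) Bool.≟ true) ×-dec (cell j (end₂ g) Bool.≟ true))
      ⊎-dec any? λ f → (boundary j f Bool.≟ true) ×-dec near? f g)

  around⁺ : ∀ {j g x y} → A ∋ g → Ends g x y → cell j ∋ x → Around j g
  around⁺ {j} {g} {x} {y} Ag E p with dichotomy (cell j y)
  ... | inj₁ q = Ag , inj₁ (inside⁺ {g = g} E p q)
  ... | inj₂ q = Ag , inj₂ (g , boundary⁺ {j} {g} Ag E p q , inj₁ refl)

  Region : Fin #C → Fin m → Set
  Region i g = ∃[ j ] (Reach ρ i j × Around j g)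

  region? : ∀ i g → Dec (Region i g)
  region? i g = any? λ j → reach? ρ i j ×-dec around? j g

  region : Fin #C → Pred m
  region i g = does (region? i g)

  -- A boundary edge may be shared by two cells. An edge inside a cell or from a cell to `v` is not,
  -- so crossing edges of this kind at different cells are distinct.
  Belongs : Fin #C → Fin m → Set
  Belongs j e = A ∋ e × ∃[ x ] ∃[ y ] (Ends e x y × cell j ∋ x × (cell j ∋ y ⊎ y ≡ v))

  ends-match : ∀ {e x y x' y'} → Ends e x y → Ends e x' y' → (x ≡ x' × y ≡ y') ⊎ (x ≡ y' × y ≡ x')
  ends-match (inj₁ (refl , refl)) (inj₁ (refl , refl)) = inj₁ (refl , refl)
  ends-match (inj₁ (refl , refl)) (inj₂ (refl , refl)) = inj₂ (refl , refl)
  ends-match (inj₂ (refl , refl)) (inj₁ (refl , refl)) = inj₂ (refl , refl)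
  ends-match (inj₂ (refl , refl)) (inj₂ (refl , refl)) = inj₁ (refl , refl)

  ends-swap : ∀ {e x y} → Ends e x y → Ends e y x
  ends-swap (inj₁ p) = inj₂ p
  ends-swap (inj₂ p) = inj₁ p

  not-v : ∀ {j x} → cell j ∋ x → x ≢ v
  not-v {j} p refl = true≢false p (v∉ j)

  belongs-unique : ∀ {i j e} → Belongs i e → Belongs j e → i ≡ j
  belongs-unique {e = e} (_ , x , y , E , p , q) (_ , x' , y' , E' , p' , q') with ends-match {e} E E'
  ... | inj₁ (refl , _) = disjoint p p'
  ... | inj₂ (refl , refl) with q'
  ...   | inj₁ r = disjoint p r
  ...   | inj₂ r = ⊥-elim (not-v p r)

  module Cut (X : Pred n) (Xv : X ∌ v) where

    Exit : Fin #C → Fin m → Set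
    Exit j g = A ∋ g × ∃[ a ] ∃[ b ] (Ends g a b × cell j ∋ a × X ∋ a × cell j ∌ b)

    exit? : ∀ j g → Dec (Exit j g)
    exit? j g = (A g Bool.≟ true) ×-dec any? λ a → any? λ b →
      ends? g a b ×-dec ((cell j a Bool.≟ true) ×-dec ((X a Bool.≟ true) ×-dec (cell j b Bool.≟ false)))

    exit-boundary : ∀ {j g} → Exit j g → boundary j ∋ g
    exit-boundary {j} {g} (Ag , a , b , E , p , _ , q) = boundary⁺ {j} {g} Ag E p q

    root-edge : ∀ j → X ∋ root j → ∃[ e ] (cross X e ≡ true × Belongs j e)
    root-edge j Xr with toV (root j) (root∈S j)
    ... | e , Ae , E = e , cross⁺ X {e} (ends-swap {e} E) Xr Xv , Ae , _ , _ , ends-swap {e} E , root∈ j , inj₂ refl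

    -- A cell from which X has an exit either has its root in X, or X splits it; in the
    -- latter case an edge inside the cell crosses X, as otherwise the part of the cell
    -- outside X would have fewer than k boundary edges.
    crossing-edge : ∀ j g → Exit j g → ∃[ e ] (cross X e ≡ true × Belongs j e)
    crossing-edge j g ex@(Ag , a , b , E , ja , Xa , jb) with dichotomy (X (root j))
    ... | inj₁ Xr = root-edge j Xr
    ... | inj₂ Xr with any? (λ e → (A e Bool.≟ true) ×-dec
            (((cell j (end₁ e) Bool.≟ true) ×-dec (cell j (end₂ e) Bool.≟ true)) ×-dec (cross X e Bool.≟ true)))
    ...   | yes (e , Ae , (p , q) , c) = e , c , Ae , _ , _ , inj₁ (refl , refl) , p , inj₁ q
    ...   | no none = ⊥-elim (<-irrefl refl (begin-strict
            suc ρ                   ≤⟨ cuts (root j) N (root∈S j) (∧⁺ (root∈ j) (not⁺ Xr)) (cong (_∧ _) (v∉ j)) ⟩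
            count (cut A N)         <⟨ count-strict grow g (exit-boundary {j} {g} ex) g∉ ⟩
            count (boundary j)      ≤⟨ small j ⟩
            suc ρ                   ∎))
      where
      open ≤-Reasoning
      N : Pred n
      N = cell j ∖ᵖ X
      grow : ∀ e → cut A N ∋ e → boundary j ∋ e
      grow e c with cross⁻ N e (∧⁻ʳ (A e) c)
      ... | x , y , F , Nx , Ny = boundary⁺ {j} {e} (∧⁻ˡ (A e) c) F jx (¬true λ jy →
            none (e , ∧⁻ˡ (A e) c , inside⁺ {g = e} F jx jy ,
              cross⁺ X {e} (ends-swap {e} F) (¬false λ Xy → true≢false (∧⁺ jy (not⁺ Xy)) Ny) (not⁻ (∧⁻ʳ (cell j x) Nx))))
        where
        jx : cell j ∋ x
        jx = ∧⁻ˡ (cell j x) Nx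
        ¬false : ∀ {β} → (β ≡ false → ⊥) → β ≡ true
        ¬false {true}  _ = refl
        ¬false {false} h = ⊥-elim (h refl)
      g∉ : cut A N ∌ g
      g∉ = ¬true λ c → absurd (cross⁻ N g (∧⁻ʳ (A g) c))
        where
        absurd : ∃[ x ] ∃[ y ] (Ends g x y × N ∋ x × N ∌ y) → ⊥
        absurd (x , y , F , Nx , _) with ends-match {g} E F
        ... | inj₁ (refl , _) = true≢false Xa (not⁻ (∧⁻ʳ (cell j a) Nx))
        ... | inj₂ (_ , refl) = true≢false (∧⁻ˡ (cell j b) Nx) jb

    Joined : Fin m → Fin m → Set
    Joined f g = f ≡ g ⊎ ∃[ h ] (Hub h × X ∋ h × star h ∋ f × class h f ∋ g)

    joined? : ∀ f g → Dec (Joined f g)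
    joined? f g = (f ≟ g) ⊎-dec any? λ h → hub? h ×-dec ((X h Bool.≟ true) ×-dec
      ((star h f Bool.≟ true) ×-dec (class h f g Bool.≟ true)))

    joined-near : ∀ {f g} → Joined f g → Near f g
    joined-near (inj₁ p) = inj₁ p
    joined-near (inj₂ (h , p , _ , q)) = inj₂ (h , p , q)

    -- Adjacency traversed within `X`: the edges leave their cells at vertices of `X`, and a hub
    -- through which they are joined lies in `X`.
    Linked : Fin #C → Fin #C → Set
    Linked i j = i ≡ j ⊎ ∃[ f ] ∃[ g ] (Exit i f × Joined f g × Exit j g)

    linked? : ∀ i j → Dec (Linked i j)
    linked? i j = (i ≟ j) ⊎-dec any? λ f → any? λ g → exit? i f ×-dec (joined? f g ×-dec exit? j g)

    linked-adj : ∀ {i j} → Linked i j → Adj i j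
    linked-adj (inj₁ p) = inj₁ p
    linked-adj {i} {j} (inj₂ (f , g , p , q , r)) =
      inj₂ (f , g , exit-boundary {i} {f} p , joined-near q , exit-boundary {j} {g} r)

    module From (i : Fin #C) (Xi : X ∋ root i) where

      open ≤-Reasoning

      Layer : ℕ → Fin #C → Set
      Layer zero    j = i ≡ j
      Layer (suc t) j = ∃[ l ] (Layer t l × Linked l j)

      layer? : ∀ t j → Dec (Layer t j)
      layer? zero    j = i ≟ j
      layer? (suc t) j = any? λ l → layer? t l ×-dec linked? l j

      layer : ℕ → Pred #C
      layer t j = does (layer? t j)

      layer-reach : ∀ t {j} → Layer t j → Reach t i j
      layer-reach zero    p = p
      layer-reach (suc t) (l , p , q) = l , layer-reach t p , linked-adj q

      -- The last change of cell on the way to `j` supplies the exit that `crossing-edge` asks for.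
      -- For `i` itself, the root in `X` serves instead.
      layer-exit : ∀ t {j} → Layer t j → i ≡ j ⊎ ∃[ g ] Exit j g
      layer-exit zero    p = inj₁ p
      layer-exit (suc t) (l , p , inj₁ refl) = layer-exit t p
      layer-exit (suc t) (l , p , inj₂ (_ , g , _ , _ , ex)) = inj₂ (g , ex)

      found : Pred m
      found e = region i e ∧ cross X e

      found⁺ : ∀ t {j e} → t ≤ ρ → Layer t j → Around j e → cross X e ≡ true → found ∋ e
      found⁺ t {j} {e} le p a c = ∧⁺ (dec-true (region? i e) (j , reach-mono le (layer-reach t p) , a)) c

      layer≤found : ∀ t → t ≤ ρ → count (layer t) ≤ count found
      layer≤found t le = count-inject (layer t) found Belongs attribute belongs-unique
        where
        attribute : ∀ j → layer t ∋ j → ∃[ e ] (found ∋ e × Belongs j e)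
        attribute j p = finish (edge (layer-exit t L))
          where
          L : Layer t j
          L = does⁻ (layer? t j) p
          edge : i ≡ j ⊎ ∃[ g ] Exit j g → ∃[ e ] (cross X e ≡ true × Belongs j e)
          edge (inj₁ refl)     = root-edge i Xi
          edge (inj₂ (g , ex)) = crossing-edge j g ex
          finish : ∃[ e ] (cross X e ≡ true × Belongs j e) → ∃[ e ] (found ∋ e × Belongs j e)
          finish (e , c , b@(Ae , x , y , E , q , _)) = e , found⁺ t le L (around⁺ {j} {e} Ae E q) c , b

      Stable : ℕ → Set
      Stable t = ∀ j → Layer (suc t) j → Layer t j

      -- A layer either gains a cell or is stable from then on. At `t = ρ` the first alternative
      -- gives `suc ρ` cells, one for each crossing edge wanted.
      growth : ∀ t → suc t ≤ count (layer t) ⊎ ∃[ s ] (s < t × Stable s)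
      growth zero = inj₁ (count≥1 i (dec-true (layer? 0 i) refl))
      growth (suc t) with growth t
      ... | inj₂ (s , lt , st) = inj₂ (s , m<n⇒m<1+n lt , st)
      ... | inj₁ le with any? (λ j → layer? (suc t) j ×-dec ¬? (layer? t j))
      ...   | yes (j , p , q) = inj₁ (≤-trans (s≤s le) (count-strict
                {p = layer t} {q = layer (suc t)}
                (λ l h → dec-true (layer? (suc t) l) (l , does⁻ (layer? t l) h , inj₁ refl))
                j (dec-true (layer? (suc t) j) p) (dec-false (layer? t j) q)))
      ...   | no none = inj₂ (t , ≤-refl , λ j p → decidable-stable (layer? t j) λ q → none (j , p , q))

      module Closed (t : ℕ) (t<ρ : t < ρ) (stable : Stable t) where

        t≤ρ : t ≤ ρ
        t≤ρ = <⇒≤ t<ρ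

        Entry : Fin n → Fin #C → Fin m → Set
        Entry h j f = Layer t j × Exit j f × star h ∋ f

        -- The part of `X` that the search has reached, with the hubs next to it. It contains
        -- `root i` and misses `v`, so at least `suc ρ` edges leave it; the aim is to show that
        -- these edges also leave `X` and lie in the region.
        InY : Fin n → Set
        InY x = X ∋ x × ((∃[ j ] (Layer t j × cell j ∋ x)) ⊎ (Hub x × ∃[ j ] ∃[ f ] Entry x j f))

        inY? : ∀ x → Dec (InY x)
        inY? x = (X x Bool.≟ true) ×-dec
          (any? (λ j → layer? t j ×-dec (cell j x Bool.≟ true)) ⊎-dec
          (hub? x ×-dec any? λ j → any? λ f → layer? t j ×-dec (exit? j f ×-dec (star x f Bool.≟ true))))

        Y : Pred n
        Y x = does (inY? x)

        -- If the far end of `g` is outside `X`, then `g` crosses `X`. Otherwise it lies in a cell: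
        -- it is not `v`, and `touched` excludes edges between two hubs. That cell is linked to `j`,
        -- so stability places it in the layer.
        through-hub : ∀ {h j f g} → Hub h → X ∋ h → Entry h j f → class h f ∋ g →
          found ∋ g ⊎ ∃[ l ] (Layer t l × boundary l ∋ g)
        through-hub {h} {j} {f} {g} hub Xh (L , ex , sf) c with star⁻ {h} {g} (proj₁ (class⁻ {h} {f} {g} c))
        ... | Ag , y , E with dichotomy (X y)
        ...   | inj₂ Xy = inj₁ (found⁺ t t≤ρ L
                (Ag , inj₂ (f , exit-boundary {j} {f} ex , inj₂ (h , hub , sf , c))) (cross⁺ X {g} E Xh Xy))
        ...   | inj₁ Xy = inj₂ (cell-end (classify y))
          where
          cell-end : (∃[ l ] cell l ∋ y) ⊎ (y ≡ v) ⊎ Hub y → ∃[ l ] (Layer t l × boundary l ∋ g)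
          cell-end (inj₁ (l , ly)) = l , stable l (j , L , inj₂ (f , g , ex , inj₂ (h , hub , Xh , sf , c) , exg)) ,
                                     exit-boundary {l} {g} exg
            where
            exg : Exit l g
            exg = Ag , y , h , ends-swap {g} E , ly , Xy , proj₁ hub l
          cell-end (inj₂ (inj₁ refl)) = ⊥-elim (true≢false Xy Xv)
          cell-end (inj₂ (inj₂ hub')) with touched g Ag
          ... | inj₂ (s , _ , F , _) with ends-match {g} E F
          ...   | inj₁ (refl , _) = ⊥-elim (proj₂ hub refl)
          ...   | inj₂ (_ , refl) = ⊥-elim (proj₂ hub' refl)
          cell-end (inj₂ (inj₂ hub')) | inj₁ (l , inj₁ p) with ends-match {g} {end₁ g} {end₂ g} (inj₁ (refl , refl)) E
          ...   | inj₁ (eq , _) = ⊥-elim (true≢false p (trans (cong (cell l) eq) (proj₁ hub l)))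
          ...   | inj₂ (eq , _) = ⊥-elim (true≢false p (trans (cong (cell l) eq) (proj₁ hub' l)))
          cell-end (inj₂ (inj₂ hub')) | inj₁ (l , inj₂ p) with ends-match {g} {end₁ g} {end₂ g} (inj₁ (refl , refl)) E
          ...   | inj₁ (_ , eq) = ⊥-elim (true≢false p (trans (cong (cell l) eq) (proj₁ hub' l)))
          ...   | inj₂ (_ , eq) = ⊥-elim (true≢false p (trans (cong (cell l) eq) (proj₁ hub l)))

        -- By `through-hub`, every edge of the class is found or on the boundary of a layer cell.
        -- The latter number at most `ρ * suc ρ`, so at least `suc ρ` edges are found.
        big-hub : ∀ {h j f} → count (layer t) ≤ ρ → Hub h → X ∋ h → Entry h j f → K ≤ count (class h f) →
          suc ρ ≤ count found
        big-hub {h} {j} {f} few hub Xh en big = +-cancelʳ-≤ (ρ * suc ρ) _ _ (begin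
          suc ρ + ρ * suc ρ                     ≤⟨ big ⟩
          count (class h f)                     ≤⟨ count-split split ⟩
          count found + count inner             ≤⟨ +-monoʳ-≤ _ (count-cover (layer t) inner boundary (suc ρ)
                                                    (λ l _ → small l) inner⁻) ⟩
          count found + count (layer t) * suc ρ ≤⟨ +-monoʳ-≤ _ (*-monoˡ-≤ (suc ρ) few) ⟩
          count found + ρ * suc ρ               ∎)
          where
          inner? : ∀ g → Dec (∃[ l ] (Layer t l × boundary l ∋ g))
          inner? g = any? λ l → layer? t l ×-dec (boundary l g Bool.≟ true)
          inner : Pred m
          inner g = does (inner? g)
          inner⁻ : ∀ g → inner ∋ g → ∃[ l ] (layer t ∋ l × boundary l ∋ g)
          inner⁻ g p = let l , L , b = does⁻ (inner? g) p in l , dec-true (layer? t l) L , b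
          split : ∀ g → class h f ∋ g → found ∋ g ⊎ inner ∋ g
          split g c with through-hub {h} {j} {f} {g} hub Xh en c
          ... | inj₁ p = inj₁ p
          ... | inj₂ q = inj₂ (dec-true (inner? g) q)

        -- Here each hub of `Y` has a single class, so `through-hub` governs its entire star. For an
        -- edge leaving `Y` from a cell, a far end in `X` would lie in the same cell, in a linked
        -- one or at a hub of `Y`. So every edge leaving `Y` crosses `X`.
        small-hubs : (∀ h → Hub h → InY h → ∃[ j ] ∃[ f ] (Entry h j f × (∀ g → star h ∋ g → class h f ∋ g))) →
          suc ρ ≤ count found
        small-hubs sm = begin
          suc ρ           ≤⟨ cuts (root i) Y (root∈S i) (dec-true (inY? (root i)) (Xi , inj₁ (i , base t , root∈ i)))
                               (dec-false (inY? v) λ (Xv' , _) → true≢false Xv' Xv) ⟩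
          count (cut A Y) ≤⟨ count-mono cover ⟩
          count found     ∎
          where
          base : ∀ t → Layer t i
          base zero    = refl
          base (suc t) = i , base t , inj₁ refl
          ¬X : ∀ {z} → (X ∋ z → InY z) → Y ∌ z → X ∌ z
          ¬X {z} into Yz = ¬true λ Xz → true≢false (dec-true (inY? z) (into Xz)) Yz
          cover : ∀ e → cut A Y ∋ e → found ∋ e
          cover e c with cross⁻ Y e (∧⁻ʳ (A e) c)
          ... | y , z , E , Yy , Yz = from (does⁻ (inY? y) Yy)
            where
            Ae : A ∋ e
            Ae = ∧⁻ˡ (A e) c
            from : InY y → found ∋ e
            from (Xy , inj₁ (j , L , jy)) =
              found⁺ t t≤ρ L (around⁺ {j} {e} Ae E jy) (cross⁺ X {e} E Xy (¬X into Yz))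
              where
              into : X ∋ z → InY z
              into Xz with dichotomy (cell j z)
              ... | inj₁ jz = Xz , inj₁ (j , L , jz)
              ... | inj₂ jz with classify z
              ...   | inj₁ (l , lz) = Xz , inj₁ (l , stable l (j , L , inj₂ (e , e ,
                        (Ae , y , z , E , jy , Xy , jz) , inj₁ refl ,
                        (Ae , z , y , ends-swap {e} E , lz , Xz , ¬true λ ly → true≢false (subst (λ o → cell o ∋ z) (disjoint ly jy) lz) jz))) , lz)
              ...   | inj₂ (inj₁ refl) = ⊥-elim (true≢false Xz Xv)
              ...   | inj₂ (inj₂ hub) = Xz , inj₂ (hub , j , e , L , (Ae , y , z , E , jy , Xy , jz) ,
                        star⁺ {z} {e} Ae (ends-swap {e} E))
            from iy@(Xy , inj₂ (hub , _)) with sm y hub iy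
            ... | j , f , en@(L , ex , sf) , all with through-hub {y} {j} {f} {e} hub Xy en (all e (star⁺ {y} {e} Ae E))
            ...   | inj₁ p = p
            ...   | inj₂ (l , Ll , bl) with boundary⁻ {l} {e} bl
            ...     | _ , x , w , F , lx , _ with ends-match {e} E F
            ...       | inj₁ (refl , _) = ⊥-elim (true≢false lx (proj₁ hub l))
            ...       | inj₂ (_ , refl) = found⁺ t t≤ρ Ll (around⁺ {l} {e} Ae (ends-swap {e} E) lx)
                          (cross⁺ X {e} E Xy (¬X (λ Xz → Xz , inj₁ (l , Ll , lx)) Yz))

        enough : suc ρ ≤ count found
        enough with suc ρ ≤? count (layer t)
        ... | yes many = ≤-trans many (layer≤found t t≤ρ)
        ... | no few with search at
          where
          at : ∀ h → suc ρ ≤ count found ⊎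
               (Hub h → InY h → ∃[ j ] ∃[ f ] (Entry h j f × (∀ g → star h ∋ g → class h f ∋ g)))
          at h with hub? h | inY? h
          ... | no ¬hub | _      = inj₂ λ hub → contradiction hub ¬hub
          ... | yes _   | no ¬iy = inj₂ λ _ iy → contradiction iy ¬iy
          ... | yes hub | yes (Xh , inj₁ (l , _ , lh)) = ⊥-elim (true≢false lh (proj₁ hub l))
          ... | yes hub | yes (Xh , inj₂ (_ , j , f , en@(_ , _ , sf))) with proj₂ (proj₂ (labelling h) f sf)
          ...   | inj₁ big = inj₁ (big-hub (≤-pred (≰⇒> few)) hub Xh en big)
          ...   | inj₂ all = inj₂ λ _ _ → j , f , en , λ g sg → class⁺ {h} {f} {g} sg (all g sg)
        ...   | inj₁ (_ , p) = p
        ...   | inj₂ sm = small-hubs sm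

      region-cut : suc ρ ≤ count found
      region-cut with growth ρ
      ... | inj₁ le = ≤-trans le (layer≤found ρ ≤-refl)
      ... | inj₂ (t , t<ρ , st) = Closed.enough t t<ρ st

-- Degree bounds and a greedy packing of regions

other-element : ∀ {n} (p : Pred n) e → 2 ≤ count p → ∃[ f ] (p ∋ f × f ≢ e)
other-element p e le with any? (λ f → (p f Bool.≟ true) ×-dec ¬? (f ≟ e))
... | yes h   = h
... | no none = ⊥-elim (<-irrefl refl (≤-trans le (≤-trans
        (count-mono λ f pf → ==⁺ (decidable-stable (f ≟ e) λ ne → none (f , pf , ne))) (count-== e))))

-- `R` is not assumed symmetric. A pick discards the elements in its own relation, so of two picks
-- only the earlier is known to avoid the later; hence the disjunction.
greedy : ∀ {c} (R : Fin c → Pred c) Δ → 1 ≤ Δ → (∀ i → count (R i) ≤ Δ) → ∀ N (U : Pred c) → N * Δ ≤ count U →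
  Σ (Fin N → Fin c) λ W → (∀ a → U ∋ W a) × (∀ a b → a ≢ b → R (W a) ∌ W b ⊎ R (W b) ∌ W a)
greedy R Δ Δ≥1 deg zero    U le = (λ ()) , (λ ()) , λ ()
greedy {c} R Δ Δ≥1 deg (suc N) U le with any? (λ i → U i Bool.≟ true)
... | no none = ⊥-elim (<-irrefl refl (begin
    1           ≤⟨ Δ≥1 ⟩
    Δ           ≤⟨ m≤m+n Δ _ ⟩
    Δ + N * Δ   ≤⟨ le ⟩
    count U     ≡⟨ count-none (λ i → ¬true λ h → none (i , h)) ⟩
    0           ∎))
  where open ≤-Reasoning
... | yes (i , Ui) with greedy R Δ Δ≥1 deg N (U ∖ᵖ R i) left
  where
  open ≤-Reasoning
  split : ∀ j → U ∋ j → R i ∋ j ⊎ (U ∖ᵖ R i) ∋ j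
  split j Uj with dichotomy (R i j)
  ... | inj₁ r = inj₁ r
  ... | inj₂ r = inj₂ (∧⁺ Uj (not⁺ r))
  left : N * Δ ≤ count (U ∖ᵖ R i)
  left = +-cancelˡ-≤ Δ _ _ (begin
    Δ + N * Δ                        ≤⟨ le ⟩
    count U                          ≤⟨ count-split split ⟩
    count (R i) + count (U ∖ᵖ R i)   ≤⟨ +-monoˡ-≤ _ (deg i) ⟩
    Δ + count (U ∖ᵖ R i)             ∎)
...   | W , WU , ind = i ◂ W , (λ { zero → Ui ; (suc a) → ∧⁻ˡ (U (W a)) (WU a) }) , λ where
        zero    zero    ne → ⊥-elim (ne refl)
        zero    (suc b) ne → inj₁ (not⁻ (∧⁻ʳ (U (W b)) (WU b)))
        (suc a) zero    ne → inj₂ (not⁻ (∧⁻ʳ (U (W a)) (WU a)))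
        (suc a) (suc b) ne → ind a b λ eq → ne (cong suc eq)

-- With q = 2k + 1, the bounds are q^2 for `near`, q^3 for `adj`, q^5 for `meet` and q for `k * 2`.
-- The exponents add up to 6ρ + 6 = 6k, which is at most 8k + 4.
degree-bound : ∀ k ρ → k ≡ suc ρ →
  let near = 1 + (2 * (k * k) + 2 * (k * k))
      adj  = 1 + k * (near * 2)
      meet = 1 + k * (near * (near * 2))
  in adj ^ ρ * meet * adj ^ ρ * (k * 2) ≤ d k
degree-bound k ρ k≡ = begin
  adj ^ ρ * meet * adj ^ ρ * (k * 2)
    ≤⟨ powers (2 * k + 1) adj meet (k * 2) (8 * k + 4) (m≤n+m 1 (2 * k)) adj≤ meet≤
         (≤-trans (≤-reflexive (*-comm k 2)) (m≤m+n (2 * k) 1))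
         (≤-trans (m≤m+n _ (2 * ρ + 6)) (≤-reflexive (trans (exponent ρ) (cong (λ x → 8 * x + 4) (sym k≡))))) ⟩
  (2 * k + 1) ^ (8 * k + 4)
    ≤⟨ enlarge ((2 * k + 1) ^ (8 * k + 4)) (subst (1 ≤_) (sym k≡) (s≤s z≤n)) ⟩
  (2 * k + 1) ^ (8 * k + 4) * k ^ 2 * (k + 1) ∎
  where
  open ≤-Reasoning
  open +-*-Solver
  near adj meet : ℕ
  near = 1 + (2 * (k * k) + 2 * (k * k))
  adj  = 1 + k * (near * 2)
  meet = 1 + k * (near * (near * 2))
  powers : ∀ q D E x e → 1 ≤ q → D ≤ q ^ 3 → E ≤ q ^ 5 → x ≤ q → 3 * ρ + 5 + 3 * ρ + 1 ≤ e →
    D ^ ρ * E * D ^ ρ * x ≤ q ^ e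
  powers q D E x e q≥1 D≤ E≤ x≤ le = begin
    D ^ ρ * E * D ^ ρ * x
      ≤⟨ *-mono-≤ (*-mono-≤ (*-mono-≤ D^≤ E≤) D^≤) x≤ ⟩
    q ^ (3 * ρ) * q ^ 5 * q ^ (3 * ρ) * q
      ≡⟨ cong (q ^ (3 * ρ) * q ^ 5 * q ^ (3 * ρ) *_) (sym (^-identityʳ q)) ⟩
    q ^ (3 * ρ) * q ^ 5 * q ^ (3 * ρ) * q ^ 1
      ≡⟨ sym (trans (^-distribˡ-+-* q (3 * ρ + 5 + 3 * ρ) 1) (cong (_* q ^ 1)
           (trans (^-distribˡ-+-* q (3 * ρ + 5) (3 * ρ)) (cong (_* q ^ (3 * ρ)) (^-distribˡ-+-* q (3 * ρ) 5))))) ⟩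
    q ^ (3 * ρ + 5 + 3 * ρ + 1)
      ≤⟨ ^-monoʳ-≤ q {{>-nonZero q≥1}} le ⟩
    q ^ e ∎
    where
    D^≤ : D ^ ρ ≤ q ^ (3 * ρ)
    D^≤ = ≤-trans (^-monoˡ-≤ ρ D≤) (≤-reflexive (^-*-assoc q 3 ρ))
  exponent : ∀ r → (3 * r + 5 + 3 * r + 1) + (2 * r + 6) ≡ 8 * suc r + 4
  exponent = solve 1 (λ r → (con 3 :* r :+ con 5 :+ con 3 :* r :+ con 1) :+ (con 2 :* r :+ con 6)
                       := con 8 :* (con 1 :+ r) :+ con 4) refl
  enlarge : ∀ y → 1 ≤ k → y ≤ y * k ^ 2 * (k + 1)
  enlarge y k≥1 = ≤-trans (m≤m*n y (k ^ 2) {{m^n≢0 k 2 {{>-nonZero k≥1}}}})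
    (m≤m*n (y * k ^ 2) (k + 1) {{>-nonZero (m≤n+m 1 k)}})
  near≤ : near ≤ (2 * k + 1) ^ 2
  near≤ = ≤-trans (m≤m+n _ (4 * k)) (≤-reflexive (eq k))
    where
    eq : ∀ x → (1 + (2 * (x * x) + 2 * (x * x))) + 4 * x ≡ (2 * x + 1) ^ 2
    eq = solve 1 (λ x → (con 1 :+ (con 2 :* (x :* x) :+ con 2 :* (x :* x))) :+ con 4 :* x
                   := (con 2 :* x :+ con 1) :^ 2) refl
  step : ∀ b x → 1 ≤ x → b ≤ x → 1 + k * (b * 2) ≤ (2 * k + 1) * x
  step b x 1≤x b≤x = begin
    1 + k * (b * 2)    ≤⟨ +-mono-≤ 1≤x (*-monoʳ-≤ k (*-monoˡ-≤ 2 b≤x)) ⟩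
    x + k * (x * 2)    ≡⟨ eq x k ⟩
    (2 * k + 1) * x    ∎
    where
    eq : ∀ x k → x + k * (x * 2) ≡ (2 * k + 1) * x
    eq = solve 2 (λ x k → x :+ k :* (x :* con 2) := (con 2 :* k :+ con 1) :* x) refl
  pos : ∀ r → 1 ≤ (2 * k + 1) ^ r
  pos r = m^n>0 (2 * k + 1) {{>-nonZero (m≤n+m 1 (2 * k))}} r
  adj≤ : adj ≤ (2 * k + 1) ^ 3
  adj≤ = step near ((2 * k + 1) ^ 2) (pos 2) near≤
  meet≤ : meet ≤ (2 * k + 1) ^ 5
  meet≤ = begin
    1 + k * (near * (near * 2)) ≡⟨ cong (λ z → 1 + k * z) (sym (*-assoc near near 2)) ⟩
    1 + k * (near * near * 2)   ≤⟨ step (near * near) ((2 * k + 1) ^ 4) (pos 4)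
        (≤-trans (*-mono-≤ near≤ near≤) (≤-reflexive (sym (^-distribˡ-+-* (2 * k + 1) 2 2)))) ⟩
    (2 * k + 1) ^ 5 ∎

product-positive : ∀ a b → 1 ≤ a → 1 ≤ b → 1 ≤ a * b * a
product-positive a b a≥1 b≥1 = *-mono-≤ (*-mono-≤ a≥1 b≥1) a≥1

cancel-scale : ∀ N Δ x {D s c} .{{_ : ℕ.NonZero x}} → Δ * x ≤ D → D * N ≤ s → s ≤ c * x → N * Δ ≤ c
cancel-scale N Δ x {D} {s} {c} Δ≤ D≤ s≤ = *-cancelʳ-≤ _ _ x (begin
  N * Δ * x   ≡⟨ *-assoc N Δ x ⟩
  N * (Δ * x) ≤⟨ *-monoʳ-≤ N Δ≤ ⟩
  N * D       ≡⟨ *-comm N D ⟩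
  D * N       ≤⟨ D≤ ⟩
  s           ≤⟨ s≤ ⟩
  c * x       ∎)
  where open ≤-Reasoning

module Packing {n m} (end₁ end₂ : Fin m → Fin n) (v : Fin n) (S : Pred n) (S∌v : S ∌ v) (ρ : ℕ) (1≤ρ : 1 ≤ ρ)
  (C : Network.Cells end₁ end₂ v S (suc ρ)) where

  open Network end₁ end₂ v S (suc ρ)
  open Cells C
  open Regions end₁ end₂ v S ρ C
  open ≤-Reasoning

  -- An edge is near itself and one class of at most `2 * K` edges at each end. A cell has at most
  -- `suc ρ` boundary edges, and an edge bounds at most two cells. Meeting surroundings cost two
  -- near-steps, and a conflict is a path of at most `ρ` adjacencies, one meeting, and at most `ρ`
  -- adjacencies back.
  nearDegree adjDegree meetDegree conflictDegree : ℕ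
  nearDegree = 1 + (2 * K + 2 * K)
  adjDegree  = 1 + suc ρ * (nearDegree * 2)
  meetDegree = 1 + suc ρ * (nearDegree * (nearDegree * 2))
  conflictDegree = adjDegree ^ ρ * meetDegree * adjDegree ^ ρ

  near : Fin m → Pred m
  near f g = does (near? f g)

  near-count : ∀ f → A ∋ f → count (near f) ≤ nearDegree
  near-count f Af = begin
    count (near f)                                         ≤⟨ count-split {q = f ==_} {r = classes} split ⟩
    count (f ==_) + count classes                          ≤⟨ +-mono-≤ (==-count f)
      (≤-trans (count-∨ (class (end₁ f) f) (class (end₂ f) f)) (+-mono-≤
        (proj₁ (proj₂ (labelling (end₁ f)) f (star⁺ {end₁ f} {f} Af (inj₁ (refl , refl)))))
        (proj₁ (proj₂ (labelling (end₂ f)) f (star⁺ {end₂ f} {f} Af (inj₂ (refl , refl))))))) ⟩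
    nearDegree                                             ∎
    where
    classes : Pred m
    classes g = class (end₁ f) f g ∨ class (end₂ f) f g
    split : ∀ g → near f ∋ g → (f == g) ≡ true ⊎ classes ∋ g
    split g p with does⁻ (near? f g) p
    ... | inj₁ eq = inj₁ (==⁺ eq)
    ... | inj₂ (h , _ , s , c) with proj₂ (star⁻ {h} {f} s)
    ...   | _ , inj₁ (refl , _) = inj₂ (∨⁺ˡ _ c)
    ...   | _ , inj₂ (_ , refl) = inj₂ (∨⁺ʳ (class (end₁ f) f g) c)

  cells-at : ∀ g → count (λ j → boundary j g) ≤ 2
  cells-at g = ≤-trans (count-split {q = λ j → cell j (end₁ g)} {r = λ j → cell j (end₂ g)} split)
    (+-mono-≤ (count≤1 λ i j → disjoint) (count≤1 λ i j → disjoint))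
    where
    split : ∀ j → boundary j ∋ g → cell j ∋ end₁ g ⊎ cell j ∋ end₂ g
    split j b with proj₂ (boundary⁻ {j} {g} b)
    ... | _ , _ , inj₁ (refl , _) , p , _ = inj₁ p
    ... | _ , _ , inj₂ (_ , refl) , p , _ = inj₂ p

  Second : Fin m → Fin #C → Set
  Second f j = ∃[ g ] (Near f g × boundary j ∋ g)

  second? : ∀ f j → Dec (Second f j)
  second? f j = any? λ g → near? f g ×-dec (boundary j g Bool.≟ true)

  second-count : ∀ f → A ∋ f → count (λ j → does (second? f j)) ≤ nearDegree * 2
  second-count f Af = ≤-trans
    (count-cover (near f) (λ j → does (second? f j)) (λ g j → boundary j g) 2 (λ g _ → cells-at g)
      λ j p → let g , q , b = does⁻ (second? f j) p in g , dec-true (near? f g) q , b)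
    (*-monoˡ-≤ 2 (near-count f Af))

  Third : Fin m → Fin #C → Set
  Third f j = ∃[ g ] (Near f g × Second g j)

  third? : ∀ f j → Dec (Third f j)
  third? f j = any? λ g → near? f g ×-dec second? g j

  third-count : ∀ f → A ∋ f → count (λ j → does (third? f j)) ≤ nearDegree * (nearDegree * 2)
  third-count f Af = ≤-trans
    (count-cover (near f) (λ j → does (third? f j)) (λ g j → does (second? g j)) (nearDegree * 2)
      (λ g p → second-count g (near-A Af (does⁻ (near? f g) p)))
      λ j p → let g , q , b = does⁻ (third? f j) p in g , dec-true (near? f g) q , dec-true (second? g j) b)
    (*-monoˡ-≤ (nearDegree * 2) (near-count f Af))

  around-count : ∀ (P : Fin m → Fin #C → Set) (P? : ∀ f j → Dec (P f j)) b →
    (∀ f → A ∋ f → count (λ j → does (P? f j)) ≤ b) → ∀ i (p : Pred #C) →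
    (∀ j → p ∋ j → i ≡ j ⊎ ∃[ f ] (boundary i ∋ f × P f j)) → count p ≤ 1 + suc ρ * b
  around-count P P? b bd i p sub = ≤-trans (count-split {q = i ==_} {r = λ j → does (far? j)} split)
    (+-mono-≤ (==-count i) (≤-trans
      (count-cover (boundary i) (λ j → does (far? j)) (λ f j → does (P? f j)) b
        (λ f q → bd f (proj₁ (boundary⁻ {i} {f} q)))
        (λ j q → let f , r , s = does⁻ (far? j) q in f , r , dec-true (P? f j) s))
      (*-monoˡ-≤ b (small i))))
    where
    far? : ∀ j → Dec (∃[ f ] (boundary i ∋ f × P f j))
    far? j = any? λ f → (boundary i f Bool.≟ true) ×-dec P? f j
    split : ∀ j → p ∋ j → (i == j) ≡ true ⊎ does (far? j) ≡ true
    split j q with sub j q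
    ... | inj₁ eq = inj₁ (==⁺ eq)
    ... | inj₂ r  = inj₂ (dec-true (far? j) r)

  adj-count : ∀ i → count (λ j → does (adj? i j)) ≤ adjDegree
  adj-count i = around-count Second second? _ second-count i _ λ j p → shape (does⁻ (adj? i j) p)
    where
    shape : ∀ {j} → Adj i j → i ≡ j ⊎ ∃[ f ] (boundary i ∋ f × Second f j)
    shape (inj₁ eq) = inj₁ eq
    shape (inj₂ (f , g , p , q , r)) = inj₂ (f , p , g , q , r)

  reach-count : ∀ r i → count (λ j → does (reach? r i j)) ≤ adjDegree ^ r
  reach-count zero    i = ==-count i
  reach-count (suc r) i = begin
    count (λ j → does (reach? (suc r) i j))
      ≤⟨ count-cover (λ l → does (reach? r i l)) _ (λ l j → does (adj? l j)) adjDegree (λ l _ → adj-count l)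
           (λ j p → let l , q , a = does⁻ (reach? (suc r) i j) p in l , dec-true (reach? r i l) q , dec-true (adj? l j) a) ⟩
    count (λ l → does (reach? r i l)) * adjDegree ≤⟨ *-monoˡ-≤ adjDegree (reach-count r i) ⟩
    adjDegree ^ r * adjDegree                     ≡⟨ *-comm (adjDegree ^ r) adjDegree ⟩
    adjDegree ^ suc r                             ∎

  reach-cons : ∀ r {i l j} → Adj i l → Reach r l j → Reach (suc r) i j
  reach-cons zero    a refl          = _ , refl , a
  reach-cons (suc r) a (x , p , b) = x , reach-cons r a p , b

  reach-sym : ∀ r {i j} → Reach r i j → Reach r j i
  reach-sym zero    p           = sym p
  reach-sym (suc r) (l , p , a) = reach-cons r (adj-sym a) (reach-sym r p)

  Meet : Fin #C → Fin #C → Set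
  Meet j j' = j ≡ j' ⊎ ∃[ f ] (boundary j ∋ f × Third f j')

  meet? : ∀ j j' → Dec (Meet j j')
  meet? j j' = (j ≟ j') ⊎-dec any? λ f → (boundary j f Bool.≟ true) ×-dec third? f j'

  meet-count : ∀ j → count (λ j' → does (meet? j j')) ≤ meetDegree
  meet-count j = around-count Third third? _ third-count j _ λ j' p → does⁻ (meet? j j') p

  -- An edge inside a cell has no end at a hub, so it is near only itself and around no other cell.
  -- Any other common edge is near a boundary edge of each of the two cells.
  around-meet : ∀ {j j' g} → Around j g → Around j' g → Meet j j'
  around-meet {g = g} (_ , inj₁ (p , _)) (_ , inj₁ (q , _)) = inj₁ (disjoint p q)
  around-meet {j} {j'} {g} (_ , inj₁ ins) (_ , inj₂ (f , b , near)) = inj₁ (sym (inside-near ins b near))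
    where
    inside-near : ∀ {i l f} → Inside i g → boundary l ∋ f → Near f g → l ≡ i
    inside-near {i} {l} (p , q) b (inj₁ refl) with proj₂ (boundary⁻ {l} {g} b)
    ... | _ , _ , inj₁ (refl , _) , r , _ = disjoint r p
    ... | _ , _ , inj₂ (_ , refl) , r , _ = disjoint r q
    inside-near {i} {l} {f} (p , q) b (inj₂ (h , hub , _ , c)) with proj₂ (star⁻ {h} {g} (proj₁ (class⁻ {h} {f} {g} c)))
    ... | _ , inj₁ (refl , _) = ⊥-elim (true≢false p (proj₁ hub i))
    ... | _ , inj₂ (_ , refl) = ⊥-elim (true≢false q (proj₁ hub i))
  around-meet {j} {j'} {g} (a , inj₂ x) (a' , inj₁ ins) with around-meet {j'} {j} {g} (a' , inj₁ ins) (a , inj₂ x)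
  ... | inj₁ eq = inj₁ (sym eq)
  ... | inj₂ (f , b , g' , n₁ , f' , n₂ , b') = inj₂ (f' , b' , g' , near-sym n₂ , f , near-sym n₁ , b)
  around-meet {j} {j'} {g} (_ , inj₂ (f , b , near)) (_ , inj₂ (f' , b' , near')) =
    inj₂ (f , b , g , near , f' , near-sym near' , b')

  Conflict : Fin #C → Fin #C → Set
  Conflict i i' = ∃[ g ] (region i ∋ g × region i' ∋ g)

  conflict? : ∀ i i' → Dec (Conflict i i')
  conflict? i i' = any? λ g → (region i g Bool.≟ true) ×-dec (region i' g Bool.≟ true)

  Approach : Fin #C → Fin #C → Set
  Approach i j' = ∃[ j ] (Reach ρ i j × Meet j j')

  approach? : ∀ i j' → Dec (Approach i j')
  approach? i j' = any? λ j → reach? ρ i j ×-dec meet? j j'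

  conflict-count : ∀ i → count (λ i' → does (conflict? i i')) ≤ conflictDegree
  conflict-count i = begin
    count (λ i' → does (conflict? i i'))
      ≤⟨ count-cover (λ j' → does (approach? i j')) _ (λ j' i' → does (reach? ρ j' i')) (adjDegree ^ ρ)
           (λ j' _ → reach-count ρ j') (λ i' p → shape i' (does⁻ (conflict? i i') p)) ⟩
    count (λ j' → does (approach? i j')) * adjDegree ^ ρ
      ≤⟨ *-monoˡ-≤ _ (count-cover (λ j → does (reach? ρ i j)) _ (λ j j' → does (meet? j j')) meetDegree
           (λ j _ → meet-count j)
           (λ j' p → let j , r , q = does⁻ (approach? i j') p in j , dec-true (reach? ρ i j) r , dec-true (meet? j j') q)) ⟩
    count (λ j → does (reach? ρ i j)) * meetDegree * adjDegree ^ ρ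
      ≤⟨ *-monoˡ-≤ _ (*-monoˡ-≤ meetDegree (reach-count ρ i)) ⟩
    conflictDegree ∎
    where
    shape : ∀ i' → Conflict i i' → ∃[ j' ] (does (approach? i j') ≡ true × does (reach? ρ j' i') ≡ true)
    shape i' (g , p , p') with does⁻ (region? i g) p | does⁻ (region? i' g) p'
    ... | j , r , a | j' , r' , a' =
      j' , dec-true (approach? i j') (j , r , around-meet {j} {j'} {g} a a') , dec-true (reach? ρ j' i') (reach-sym ρ r')

  -- Every `s` in `S` is an end of a boundary edge of some cell. If `s` lies in a cell, its edge to
  -- `v` is one. If `s` is a hub, the cut around `s` alone has a second edge, as `suc ρ` is at least
  -- 2; being second, it is not the sole link of `s` to `v`, so `touched` puts its other end in a
  -- cell.
  S-count : count S ≤ #C * (suc ρ * 2)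
  S-count = begin
    count S                             ≤⟨ count-cover (λ _ → true) S (λ i s → does (meets? i s)) (suc ρ * 2)
                                            (λ i _ → per-cell i) (λ s Ss → let i , w = locate s Ss in i , refl , dec-true (meets? i s) w) ⟩
    count {#C} (λ _ → true) * (suc ρ * 2) ≡⟨ cong (_* (suc ρ * 2)) (count-all {#C}) ⟩
    #C * (suc ρ * 2)                    ∎
    where
    end : Fin m → Pred n
    end f s = (end₁ f == s) ∨ (end₂ f == s)
    Meets : Fin #C → Fin n → Set
    Meets i s = ∃[ f ] (boundary i ∋ f × end f ∋ s)
    meets? : ∀ i s → Dec (Meets i s)
    meets? i s = any? λ f → (boundary i f Bool.≟ true) ×-dec (end f s Bool.≟ true)
    per-cell : ∀ i → count (λ s → does (meets? i s)) ≤ suc ρ * 2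
    per-cell i = ≤-trans (count-cover (boundary i) _ end 2
        (λ f _ → ≤-trans (count-∨ (end₁ f ==_) (end₂ f ==_)) (+-mono-≤ (==-count (end₁ f)) (==-count (end₂ f))))
        (λ s p → does⁻ (meets? i s) p))
      (*-monoˡ-≤ 2 (small i))
    end⁺ : ∀ {f s y} → Ends f s y → end f ∋ s
    end⁺ {f} {s} (inj₁ (p , _)) = ∨⁺ˡ _ (==⁺ p)
    end⁺ {f} {s} (inj₂ (_ , p)) = ∨⁺ʳ (end₁ f == s) (==⁺ p)
    locate : ∀ s → S ∋ s → ∃[ i ] Meets i s
    locate s Ss with toV s Ss | classify s
    ... | e , Ae , E | inj₁ (i , p) = i , e , boundary⁺ {i} {e} Ae (ends-swap {e} E) p (v∉ i) , end⁺ {e} (ends-swap {e} E)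
    ... | e , Ae , E | inj₂ (inj₁ refl) = ⊥-elim (true≢false Ss S∌v)
    ... | e , Ae , E | inj₂ (inj₂ hub)
      with other-element (cut A (_== s)) e (≤-trans (s≤s 1≤ρ) (cuts s (_== s) Ss (==-refl s) (≢⁺ (proj₂ hub ∘ sym))))
    ...   | f , c , f≢e with cross⁻ (_== s) f (∧⁻ʳ (A f) c)
    ...     | x , y , F , xs , ys with ==⁻ x s xs
    ...       | refl with touched f (∧⁻ˡ (A f) c)
    ...         | inj₂ (s' , _ , F' , only) with ends-match {f} F F'
    ...           | inj₁ (refl , _) = ⊥-elim (proj₂ hub refl)
    ...           | inj₂ (refl , _) = ⊥-elim (f≢e (sym (only e Ae E)))
    locate s Ss | e , Ae , E | inj₂ (inj₂ hub) | f , c , f≢e | x , y , F , xs , ys | refl | inj₁ (i , p) =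
      i , f , boundary⁺ {i} {f} (∧⁻ˡ (A f) c) (ends-swap {f} F) (other p F) (proj₁ hub i) , end⁺ {f} F
      where
      other : cell i ∋ end₁ f ⊎ cell i ∋ end₂ f → Ends f x y → cell i ∋ y
      other (inj₁ p) (inj₁ (refl , _)) = ⊥-elim (true≢false p (proj₁ hub i))
      other (inj₁ p) (inj₂ (refl , _)) = p
      other (inj₂ p) (inj₁ (_ , refl)) = p
      other (inj₂ p) (inj₂ (_ , refl)) = ⊥-elim (true≢false p (proj₁ hub i))

  -- Each cell accounts for at most `suc ρ * 2` vertices of `S`. Dividing by this number leaves
  -- `conflictDegree` cells per requested one, which is what the greedy choice consumes.
  select : ∀ D N → conflictDegree * (suc ρ * 2) ≤ D → D * N ≤ count S →
    Σ (Fin N → Fin #C) λ W → ∀ {a b g} → region (W a) ∋ g → region (W b) ∋ g → a ≡ b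
  select D N D≥ le = finish (greedy (λ i i' → does (conflict? i i')) conflictDegree
      (product-positive (adjDegree ^ ρ) meetDegree (m^n>0 adjDegree ρ) (s≤s z≤n)) conflict-count N (λ _ → true)
      (subst (N * conflictDegree ≤_) (sym (count-all {#C}))
        (cancel-scale N conflictDegree (suc ρ * 2) D≥ le S-count)))
    where
    finish : Σ (Fin N → Fin #C) (λ W → (∀ a → true ≡ true) ×
               (∀ a b → a ≢ b → does (conflict? (W a) (W b)) ≡ false ⊎ does (conflict? (W b) (W a)) ≡ false)) →
             Σ (Fin N → Fin #C) λ W → ∀ {a b g} → region (W a) ∋ g → region (W b) ∋ g → a ≡ b
    finish (W , _ , ind) = W , λ {a} {b} {g} p q → decidable-stable (a ≟ b) λ ne → clash a b g p q (ind a b ne)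
      where
      clash : ∀ a b g → region (W a) ∋ g → region (W b) ∋ g →
        does (conflict? (W a) (W b)) ≡ false ⊎ does (conflict? (W b) (W a)) ≡ false → ⊥
      clash a b g p q (inj₁ h) = true≢false (dec-true (conflict? (W a) (W b)) (g , p , q)) h
      clash a b g p q (inj₂ h) = true≢false (dec-true (conflict? (W b) (W a)) (g , q , p)) h

-- Ranks, subsets, and cycles from walks

rank : ∀ {n} → Pred n → Fin n → ℕ
rank p zero    = 0
rank p (suc i) = bit (p zero) + rank (p ∘ suc) i

rank<count : ∀ {n} {p : Pred n} i → p ∋ i → rank p i < count p
rank<count zero pi rewrite pi = s≤s z≤n
rank<count {p = p} (suc i) pi = subst (_≤ count p) (+-suc (bit (p zero)) _) (+-monoʳ-≤ (bit (p zero)) (rank<count i pi))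

rank-injective : ∀ {n} {p : Pred n} i j → p ∋ i → p ∋ j → rank p i ≡ rank p j → i ≡ j
rank-injective zero    zero    _  _  _  = refl
rank-injective zero    (suc j) pi _  eq rewrite pi with eq
... | ()
rank-injective (suc i) zero    _  pj eq rewrite pj with eq
... | ()
rank-injective {p = p} (suc i) (suc j) pi pj eq =
  cong suc (rank-injective i j pi pj (+-cancelˡ-≡ (bit (p zero)) _ _ eq))

∈-tabulate⁺ : ∀ {n} {p : Pred n} {i} → p ∋ i → i ∈ tabulate p
∈-tabulate⁺ {p = p} {i} h = lookup⇒[]= i (tabulate p) (trans (lookup∘tabulate p i) h)

∈-tabulate⁻ : ∀ {n} {p : Pred n} {i} → i ∈ tabulate p → p ∋ i
∈-tabulate⁻ {p = p} {i} h = trans (sym (lookup∘tabulate p i)) ([]=⇒lookup h)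

size-lookup : ∀ {n} (A : Subset n) → ∣ A ∣ ≡ count (lookup A)
size-lookup []          = refl
size-lookup (true ∷ A)  = cong suc (size-lookup A)
size-lookup (false ∷ A) = size-lookup A

size-tabulate : ∀ {n} (p : Pred n) → ∣ tabulate p ∣ ≡ count p
size-tabulate p = trans (size-lookup (tabulate p)) (count-cong (lookup∘tabulate p))

module Walks (G : Graph) where

  open Graph G using (Joins; walkEdges; walkVertices)

  vertices : ∀ {A u v} → Walk G A u v → List (Vertex G)
  vertices {u = u} ε       = u ∷ []
  vertices {u = u} (_ ◅ p) = u ∷ vertices p

  first∈ : ∀ {A u v} (p : Walk G A u v) → u ∈ˡ vertices p
  first∈ ε       = here refl
  first∈ (_ ◅ p) = here refl

  last∈ : ∀ {A u v} (p : Walk G A u v) → v ∈ˡ vertices p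
  last∈ ε       = here refl
  last∈ (_ ◅ p) = there (last∈ p)

  walkVertices⊆ : ∀ {A u v x} (p : Walk G A u v) → x ∈ˡ walkVertices p → x ∈ˡ vertices p
  walkVertices⊆ (_ ◅ p) (here eq) = here eq
  walkVertices⊆ (_ ◅ p) (there h) = there (walkVertices⊆ p h)

  joins-∈ : ∀ {e x y} → Joins e x y → ∀ {x' y'} → Joins e x' y' → x ≡ x' ⊎ x ≡ y'
  joins-∈ (inj₁ p) (inj₁ q) = inj₁ (cong proj₁ (trans (sym p) q))
  joins-∈ (inj₁ p) (inj₂ q) = inj₂ (cong proj₁ (trans (sym p) q))
  joins-∈ (inj₂ p) (inj₁ q) = inj₂ (cong proj₂ (trans (sym p) q))
  joins-∈ (inj₂ p) (inj₂ q) = inj₁ (cong proj₂ (trans (sym p) q))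

  edge-end∈ : ∀ {A u v e x y} (p : Walk G A u v) → e ∈ˡ walkEdges p → Joins e x y → x ∈ˡ vertices p
  edge-end∈ ((_ , _ , j) ◅ p) (here refl) i with joins-∈ i j
  ... | inj₁ refl = here refl
  ... | inj₂ refl = there (first∈ p)
  edge-end∈ (_ ◅ p) (there h) i = there (edge-end∈ p h i)

  Simple : ∀ {A u v} → Walk G A u v → Set
  Simple ε               = ⊤
  Simple {u = u} (_ ◅ p) = ¬ (u ∈ˡ vertices p) × Simple p

  suffix : ∀ {A u v x} (p : Walk G A u v) → Simple p → x ∈ˡ vertices p → Σ (Walk G A x v) Simple
  suffix ε       s       (here refl) = ε , tt
  suffix (g ◅ p) s       (here refl) = g ◅ p , s
  suffix (g ◅ p) (_ , s) (there h)   = suffix p s h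

  simplify : ∀ {A u v} → Walk G A u v → Σ (Walk G A u v) Simple
  simplify ε = ε , tt
  simplify {u = u} (g ◅ p) with simplify p
  ... | q , s with Any.any? (u ≟_) (vertices q)
  ...   | yes h = suffix q s h
  ...   | no ¬h = g ◅ q , ¬h , s

  all-≢ : ∀ {X : Set} {x : X} {xs} → ¬ (x ∈ˡ xs) → All (x ≢_) xs
  all-≢ {xs = xs} = ¬Any⇒All¬ xs

  unique-vertices : ∀ {A u v} (p : Walk G A u v) → Simple p → Unique (walkVertices p)
  unique-vertices ε       _       = []
  unique-vertices (_ ◅ p) (h , s) = all-≢ (h ∘ walkVertices⊆ p) ∷ unique-vertices p s

  unique-edges : ∀ {A u v} (p : Walk G A u v) → Simple p → Unique (walkEdges p)
  unique-edges ε                 _       = []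
  unique-edges ((_ , _ , j) ◅ p) (h , s) = all-≢ (λ e∈ → h (edge-end∈ p e∈ j)) ∷ unique-edges p s

  last∉ : ∀ {A u v} (p : Walk G A u v) → Simple p → ¬ (v ∈ˡ walkVertices p)
  last∉ (_ ◅ p) (h , s) (here refl) = h (last∈ p)
  last∉ (_ ◅ p) (h , s) (there x)   = last∉ p s x

  module _ {A A' : Subset (#E G)} (A'⊆A : ∀ {e} → e ∈ A' → e ∈ A) where

    widen : ∀ {u v} → Walk G A' u v → Walk G A u v
    widen ε                 = ε
    widen ((e , e∈ , j) ◅ p) = (e , A'⊆A e∈ , j) ◅ widen p

    widen-vertices : ∀ {u v} (p : Walk G A' u v) → walkVertices (widen p) ≡ walkVertices p
    widen-vertices ε       = refl
    widen-vertices (_ ◅ p) = cong (_ ∷_) (widen-vertices p)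

    widen-edges : ∀ {u v} (p : Walk G A' u v) → walkEdges (widen p) ≡ walkEdges p
    widen-edges ε       = refl
    widen-edges (_ ◅ p) = cong (_ ∷_) (widen-edges p)

  edges⊆ : ∀ {A u v e} (p : Walk G A u v) → e ∈ˡ walkEdges p → e ∈ A
  edges⊆ ((_ , e∈ , _) ◅ p) (here refl) = e∈
  edges⊆ (_ ◅ p)            (there h)   = edges⊆ p h

  -- That `e` is outside `A'` keeps the edges of the cycle distinct even if the simplified walk is a
  -- single edge parallel to `e`.
  close : ∀ {A A' u y e} → (∀ {g} → g ∈ A' → g ∈ A) → e ∈ A → ¬ (e ∈ A') → Joins e u y →
    Walk G A' y u → CycleThrough G A u
  close {u = u} {e = e} A'⊆A e∈A e∉A' j w with simplify w
  ... | p , s = (e , e∈A , j) ◅ widen A'⊆A p , (λ ()) ,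
    subst (λ l → Unique (u ∷ l)) (sym (widen-vertices A'⊆A p)) (all-≢ (last∉ p s) ∷ unique-vertices p s) ,
    subst (λ l → Unique (e ∷ l)) (sym (widen-edges A'⊆A p)) (all-≢ (e∉A' ∘ edges⊆ p) ∷ unique-edges p s)

  reverse-walk : ∀ {A u v} → Walk G A u v → Walk G A v u
  reverse-walk = reverse λ { (e , e∈ , inj₁ j) → e , e∈ , inj₂ j ; (e , e∈ , inj₂ j) → e , e∈ , inj₁ j }

  -- The first edge e of a simple walk p from u to v is not used again; the rest of p,
  -- followed by the reverse of q, leads back to u without e.
  two-walks-cycle : ∀ {A₁ A₂ A u v} → u ≢ v → (∀ {e} → e ∈ A₁ → e ∈ A) → (∀ {e} → e ∈ A₂ → e ∈ A) →
    (∀ {e} → e ∈ A₁ → ¬ (e ∈ A₂)) → Walk G A₁ u v → Walk G A₂ u v → CycleThrough G A u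
  two-walks-cycle {A₁} {A₂} {A} {u} {v} u≢v A₁⊆A A₂⊆A disj p q with simplify p
  ... | ε , _ = ⊥-elim (u≢v refl)
  ... | (e , e∈ , j) ◅ r , (u∉ , s) =
    close {A' = A'} A'⊆A (A₁⊆A e∈) e∉A' j (rest r u∉ ◅◅ reverse-walk (widen A₂⊆A' q))
    where
    A' : Subset (#E G)
    A' = tabulate λ g → lookup A g ∧ not (g == e)
    A'⁺ : ∀ {g} → g ∈ A → g ≢ e → g ∈ A'
    A'⁺ g∈ ne = ∈-tabulate⁺ (∧⁺ ([]=⇒lookup g∈) (not⁺ (≢⁺ ne)))
    A'⊆A : ∀ {g} → g ∈ A' → g ∈ A
    A'⊆A {g} g∈ = lookup⇒[]= g A (∧⁻ˡ (lookup A g) (∈-tabulate⁻ g∈))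
    e∉A' : ¬ (e ∈ A')
    e∉A' e∈' = true≢false (==-refl e) (not⁻ (∧⁻ʳ (lookup A e) (∈-tabulate⁻ e∈')))
    A₂⊆A' : ∀ {g} → g ∈ A₂ → g ∈ A'
    A₂⊆A' g∈ = A'⁺ (A₂⊆A g∈) λ { refl → disj e∈ g∈ }
    rest : ∀ {x} (r : Walk G A₁ x v) → ¬ (u ∈ˡ vertices r) → Walk G A' x v
    rest ε _ = ε
    rest ((g , g∈ , i) ◅ r) h =
      (g , A'⁺ (A₁⊆A g∈) (λ { refl → h (edge-end∈ ((g , g∈ , i) ◅ r) (here refl) j) }) , i) ◅ rest r (h ∘ there)

-- Assembling the immersion from paths to the centre

module Slots (F : Graph) (k : ℕ) (Δ≤k : MaxDegree≤ k F) where

  at : Edge F → Bool → Vertex F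
  at e true  = proj₁ (ends F e)
  at e false = proj₂ (ends F e)

  atVertex : Bool → Vertex F → Pred (#E F)
  atVertex b x e = at e b == x

  -- Numbers the half-edges at a vertex of `F`, those at first ends before those at second ends. A
  -- loop occupies two positions, just as it counts twice in the degree, so the degree bound makes
  -- all positions fit below `k`.
  position : Edge F → Bool → ℕ
  position e true  = rank (atVertex true (at e true)) e
  position e false = count (atVertex true (at e false)) + rank (atVertex false (at e false)) e

  position<k : ∀ e b → position e b < k
  position<k e b = ≤-trans (bound b) (≤-trans (≤-reflexive (sym (degree≡ (at e b)))) (Δ≤k (at e b)))
    where
    degree≡ : ∀ x → degree F x ≡ count (atVertex true x) + count (atVertex false x)
    degree≡ x = cong₂ _+_ (size-tabulate (atVertex true x)) (size-tabulate (atVertex false x))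
    bound : ∀ b → position e b < count (atVertex true (at e b)) + count (atVertex false (at e b))
    bound true  = ≤-trans (rank<count e (==-refl (at e true))) (m≤m+n _ _)
    bound false = +-monoʳ-< (count (atVertex true (at e false))) (rank<count e (==-refl (at e false)))

  slot : Edge F → Bool → Fin k
  slot e b = fromℕ< (position<k e b)

  position-injective : ∀ {e b e' b'} → at e b ≡ at e' b' → position e b ≡ position e' b' → e ≡ e' × b ≡ b'
  position-injective {e} {true} {e'} {true} a p rewrite a =
    rank-injective {p = atVertex true (at e' true)} e e' (==⁺ a) (==-refl (at e' true)) p , refl
  position-injective {e} {false} {e'} {false} a p rewrite a =
    rank-injective {p = atVertex false (at e' false)} e e' (==⁺ a) (==-refl (at e' false))
      (+-cancelˡ-≡ (count (atVertex true (at e' false))) _ _ p) , refl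
  position-injective {e} {true} {e'} {false} a p rewrite a =
    ⊥-elim (<⇒≢ (≤-trans (rank<count {p = atVertex true (at e' false)} e (==⁺ a)) (m≤m+n _ _)) p)
  position-injective {e} {false} {e'} {true} a p rewrite a =
    ⊥-elim (<⇒≢ (≤-trans (rank<count {p = atVertex true (at e' true)} e' (==-refl (at e' true))) (m≤m+n _ _)) (sym p))

  slot-injective : ∀ {e b e' b'} → at e b ≡ at e' b' → slot e b ≡ slot e' b' → e ≡ e' × b ≡ b'
  slot-injective {e} {b} {e'} {b'} a s = position-injective a
    (trans (sym (toℕ-fromℕ< (position<k e b))) (trans (cong toℕ s) (toℕ-fromℕ< (position<k e' b'))))

-- An edge ab of F is realized by the walk of its slot at a to v together with the
-- walk of its slot at b to v.

module Assembly (F G : Graph) (k : ℕ) (Δ≤k : MaxDegree≤ k F) (v : Vertex G)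
  (w : Vertex F → Vertex G) (w≢v : ∀ a → w a ≢ v) (P : Vertex F → Fin k → Pred (#E G)) where

  open Graph G using (Joins)
  open Walks G
  open Slots F k Δ≤k

  end₁ end₂ : Edge G → Vertex G
  end₁ g = proj₁ (ends G g)
  end₂ g = proj₂ (ends G g)

  open Undirected end₁ end₂ using (UStep)

  module _
    (route    : ∀ a s → Star (UStep (P a s)) (w a) v)
    (spread   : ∀ a s g → P a s ∋ g → Star (UStep (P a s)) (end₁ g) v × Star (UStep (P a s)) (end₂ g) v)
    (disjoint : ∀ {a b s t g} → P a s ∋ g → P b t ∋ g → a ≡ b × s ≡ t)
    (private-vertex : ∀ {a b s g} → P a s ∋ g → end₁ g ≡ w b ⊎ end₂ g ≡ w b → a ≡ b)
    where

    joins : ∀ {g x y} → end₁ g ≡ x × end₂ g ≡ y ⊎ end₁ g ≡ y × end₂ g ≡ x → Joins g x y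
    joins (inj₁ (refl , refl)) = inj₁ refl
    joins (inj₂ (refl , refl)) = inj₂ refl

    toWalk : ∀ {Q A x y} → (∀ {g} → Q ∋ g → g ∈ A) → Star (UStep Q) x y → Walk G A x y
    toWalk sub = mapStar λ { (g , q , j) → g , sub q , joins j }

    edgeSet : Edge F → Pred (#E G)
    edgeSet e g = P (at e true) (slot e true) g ∨ P (at e false) (slot e false) g

    edgeSet⁺ : ∀ e b {g} → P (at e b) (slot e b) ∋ g → edgeSet e ∋ g
    edgeSet⁺ e true  p = ∨⁺ˡ _ p
    edgeSet⁺ e false p = ∨⁺ʳ (P (at e true) (slot e true) _) p

    edgeSet⁻ : ∀ e {g} → edgeSet e ∋ g → ∃[ b ] P (at e b) (slot e b) ∋ g
    edgeSet⁻ e {g} p with ∨⁻ (P (at e true) (slot e true) g) p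
    ... | inj₁ q = true , q
    ... | inj₂ q = false , q

    -- The vertices of an image are exactly the ends of its edges. Strongness thereby becomes a
    -- condition on edges at branch vertices, and every vertex of the image inherits a walk to `v`.
    OnEdge : Edge F → Vertex G → Set
    OnEdge e x = ∃[ g ] (edgeSet e ∋ g × (end₁ g ≡ x ⊎ end₂ g ≡ x))

    onEdge? : ∀ e x → Dec (OnEdge e x)
    onEdge? e x = any? λ g → (edgeSet e g Bool.≟ true) ×-dec ((end₁ g ≟ x) ⊎-dec (end₂ g ≟ x))

    onEdge⁻ : ∀ {e x} → x ∈ tabulate (λ x → does (onEdge? e x)) → OnEdge e x
    onEdge⁻ {e} {x} h = does⁻ (onEdge? e x) (∈-tabulate⁻ h)

    onEdge⁺ : ∀ {e x} → OnEdge e x → x ∈ tabulate (λ x → does (onEdge? e x))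
    onEdge⁺ {e} {x} h = ∈-tabulate⁺ (dec-true (onEdge? e x) h)

    image : Edge F → Subgraph G
    image e = record
      { V = tabulate λ x → does (onEdge? e x)
      ; E = tabulate (edgeSet e)
      ; closed = λ {g} g∈ → onEdge⁺ (g , ∈-tabulate⁻ g∈ , inj₁ refl) , onEdge⁺ (g , ∈-tabulate⁻ g∈ , inj₂ refl)
      }

    slotWalk : ∀ e b {x y} → Star (UStep (P (at e b) (slot e b))) x y → Walk G (tabulate (edgeSet e)) x y
    slotWalk e b = toWalk (λ p → ∈-tabulate⁺ (edgeSet⁺ e b p))

    walkToV : ∀ {e x} → OnEdge e x → Walk G (tabulate (edgeSet e)) x v
    walkToV {e} (g , p , q) with edgeSet⁻ e p
    ... | b , pb with spread (at e b) (slot e b) g pb | q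
    ...   | r , _ | inj₁ refl = slotWalk e b r
    ...   | _ , r | inj₂ refl = slotWalk e b r

    firstEdge : ∀ {Q x} → x ≢ v → Star (UStep Q) x v → ∃[ g ] (Q ∋ g × (end₁ g ≡ x ⊎ end₂ g ≡ x))
    firstEdge ne ε                              = ⊥-elim (ne refl)
    firstEdge ne ((g , q , inj₁ (eq , _)) ◅ _) = g , q , inj₁ eq
    firstEdge ne ((g , q , inj₂ (_ , eq)) ◅ _) = g , q , inj₂ eq

    branch-on : ∀ e b → OnEdge e (w (at e b))
    branch-on e b with firstEdge (w≢v (at e b)) (route (at e b) (slot e b))
    ... | g , q , i = g , edgeSet⁺ e b q , i

    -- The path in slot zero starts with an edge at `w a`; if `w b` is the same vertex, privacy of
    -- that edge identifies `a` with `b`.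
    w-injective : k ≥ 1 → ∀ {a b} → w a ≡ w b → a ≡ b
    w-injective (s≤s _) {a} {b} eq with firstEdge (w≢v a) (route a zero)
    ... | g , q , inj₁ i = private-vertex q (inj₁ (trans i eq))
    ... | g , q , inj₂ i = private-vertex q (inj₂ (trans i eq))

    immersion : k ≥ 1 → Immersion F G
    immersion k≥1 = record
      { θV = w
      ; θE = image
      ; injective = w-injective k≥1
      ; connected = λ e → (w (at e true) , onEdge⁺ (branch-on e true)) , λ x∈ y∈ →
          walkToV {e} (onEdge⁻ x∈) ◅◅ reverse-walk (walkToV {e} (onEdge⁻ y∈))
      ; edgeDisjoint = λ {e} {f} e≢f (g , g∈) → clash e f e≢f g (x∈p∩q⁻ _ _ g∈)
      ; incident = λ { {e} (inj₁ refl) → onEdge⁺ (branch-on e true) ; {e} (inj₂ refl) → onEdge⁺ (branch-on e false) }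
      ; loop = λ {e} → cycle e
      }
      where
      clash : ∀ e f → e ≢ f → ∀ g → g ∈ tabulate (edgeSet e) × g ∈ tabulate (edgeSet f) → ⊥
      clash e f e≢f g (p , q) with edgeSet⁻ e (∈-tabulate⁻ p) | edgeSet⁻ f (∈-tabulate⁻ q)
      ... | b , pb | c , qc with disjoint pb qc
      ...   | a≡ , s≡ = e≢f (proj₁ (slot-injective {e} {b} {f} {c} a≡ s≡))
      cycle : ∀ e {x} → LoopAt F e x → CycleThrough G (tabulate (edgeSet e)) (w x)
      cycle e {x} eq = two-walks-cycle {A₁ = tabulate (P (at e true) (slot e true))} {A₂ = tabulate (P (at e false) (slot e false))}
        (w≢v x)
        (λ g∈ → ∈-tabulate⁺ (edgeSet⁺ e true (∈-tabulate⁻ g∈)))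
        (λ g∈ → ∈-tabulate⁺ (edgeSet⁺ e false (∈-tabulate⁻ g∈)))
        (λ g∈ h∈ → different (disjoint (∈-tabulate⁻ g∈) (∈-tabulate⁻ h∈)))
        (subst (λ y → Walk G _ (w y) v) (cong proj₁ eq) (toWalk ∈-tabulate⁺ (route (at e true) (slot e true))))
        (subst (λ y → Walk G _ (w y) v) (cong proj₂ eq) (toWalk ∈-tabulate⁺ (route (at e false) (slot e false))))
        where
        different : at e true ≡ at e false × slot e true ≡ slot e false → ⊥
        different (a≡ , s≡) with slot-injective {e} {true} {e} {false} a≡ s≡
        ... | ()

    strong : (k≥1 : k ≥ 1) → Strong (immersion k≥1)
    strong k≥1 {e} {x} not-incident x∈ with onEdge⁻ {e} x∈
    ... | g , p , i with edgeSet⁻ e p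
    ...   | true  , q = not-incident (inj₁ (private-vertex q i))
    ...   | false , q = not-incident (inj₂ (private-vertex q i))

-- From edge-connectivity to the immersion

module Neighbourhood (ρ : ℕ) (G : Graph) (conn : EdgeConnected (suc ρ) G) (v : Vertex G)
  (S : Subset (#V G)) (neighbours : ∀ {s} → s ∈ S → Graph.Neighbour G v s) where

  end₁ end₂ : Edge G → Vertex G
  end₁ g = proj₁ (ends G g)
  end₂ g = proj₂ (ends G g)

  open Network end₁ end₂ v (lookup S) (suc ρ)

  walk-crosses : ∀ X {Z x y} → Walk G Z x y → X ∋ x → X ∌ y → ∃[ e ] (e ∈ Z × cross X e ≡ true)
  walk-crosses X ε Xx Xy = ⊥-elim (true≢false Xx Xy)
  walk-crosses X (_◅_ {j = z} (e , e∈ , j) p) Xx Xy with dichotomy (X z)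
  ... | inj₁ Xz = walk-crosses X p Xz Xy
  ... | inj₂ Xz = e , e∈ , cross⁺ X {e} (ends⁺ j) Xx Xz
    where
    ends⁺ : ∀ {x y} → Graph.Joins G e x y → Ends e x y
    ends⁺ (inj₁ eq) = inj₁ (cong proj₁ eq , cong proj₂ eq)
    ends⁺ (inj₂ eq) = inj₂ (cong proj₁ eq , cong proj₂ eq)

  connects : Connects (λ _ → true)
  connects s Ss = edge (proj₂ (neighbours (lookup⇒[]= s S Ss))) , cut-large
    where
    edge : ∃[ e ] Graph.Joins G e v s → ∃[ e ] (true ≡ true × Ends e v s)
    edge (e , inj₁ eq) = e , refl , inj₁ (cong proj₁ eq , cong proj₂ eq)
    edge (e , inj₂ eq) = e , refl , inj₂ (cong proj₁ eq , cong proj₂ eq)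
    cut-large : ∀ X → X ∋ s → X ∌ v → suc ρ ≤ count (cut (λ _ → true) X)
    cut-large X Xs Xv with suc ρ ≤? count (cross X)
    ... | yes le = le
    ... | no few with conn (tabulate (cross X)) (subst (_< suc ρ) (sym (size-tabulate (cross X))) (≰⇒> few))
    ...   | _ , walk with walk-crosses X (walk ∈⊤ ∈⊤) Xs Xv
    ...     | e , e∈ , c = ⊥-elim (x∈∁p⇒x∉p e∈ (∈-tabulate⁺ c))

  S∌v : lookup S ∌ v
  S∌v = ¬true λ h → proj₁ (neighbours (lookup⇒[]= v S h)) refl

  C : Cells
  C = cells (λ _ → true) connects

module Realization (ρ : ℕ) (F G : Graph) (Δ≤k : MaxDegree≤ (suc ρ) F) (v : Vertex G) (S : Pred (#V G))
  (C : Network.Cells (proj₁ ∘ ends G) (proj₂ ∘ ends G) v S (suc ρ)) where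

  end₁ end₂ : Edge G → Vertex G
  end₁ = proj₁ ∘ ends G
  end₂ = proj₂ ∘ ends G

  open Network end₁ end₂ v S (suc ρ)
  open Cells C
  open Regions end₁ end₂ v S ρ C

  realize : (Σ (Fin (#V F) → Fin #C) λ W → ∀ {a b g} → region (W a) ∋ g → region (W b) ∋ g → a ≡ b) →
    StrongImmersion F G
  realize (W , apart) = immersion route spread disjoint' private-vertex (s≤s z≤n) ,
                        strong route spread disjoint' private-vertex (s≤s z≤n)
    where
    routing : ∀ a → _
    routing a = menger (region (W a)) (root (W a)) v (suc ρ) λ X Xr Xv → Cut.From.region-cut X Xv (W a) Xr
    P : Vertex F → Fin (suc ρ) → Pred (#E G)
    P a s g = isJust= s (proj₁ (routing a) g)
    w : Vertex F → Vertex G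
    w a = root (W a)
    open Assembly F G (suc ρ) Δ≤k v w (λ a → not-v {W a} (root∈ (W a))) P using (immersion; strong)
    route : ∀ a s → Star (UStep (P a s)) (w a) v
    route a = proj₁ (proj₂ (routing a))
    spread : ∀ a s g → P a s ∋ g → Star (UStep (P a s)) (end₁ g) v × Star (UStep (P a s)) (end₂ g) v
    spread a s g p = proj₂ (proj₂ (proj₂ (routing a)) s g p)
    inRegion : ∀ {a s g} → P a s ∋ g → region (W a) ∋ g
    inRegion {a} {s} {g} p = proj₁ (proj₂ (proj₂ (routing a)) s g p)
    owner : ∀ {s t : Fin (suc ρ)} o → isJust= s o ≡ true → isJust= t o ≡ true → s ≡ t
    owner {s} {t} (just r) p q = trans (==⁻ s r p) (sym (==⁻ t r q))
    disjoint' : ∀ {a b s t g} → P a s ∋ g → P b t ∋ g → a ≡ b × s ≡ t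
    disjoint' {a} {b} {s} {t} {g} p q with apart (inRegion {a} {s} {g} p) (inRegion {b} {t} {g} q)
    ... | refl = refl , owner (proj₁ (routing a) g) p q
    -- Every edge of `A` at the root of a cell is around that cell and so in its region.
    -- Disjointness of the regions therefore already keeps the paths of one branch vertex away from
    -- the others, which is what makes the immersion strong.
    private-vertex : ∀ {a b s g} → P a s ∋ g → end₁ g ≡ w b ⊎ end₂ g ≡ w b → a ≡ b
    private-vertex {a} {b} {s} {g} p i =
      apart (inRegion {a} {s} {g} p) (dec-true (region? (W b) g) (W b , reach-mono {s = ρ} z≤n refl , at-root i))
      where
      Ag : A ∋ g
      Ag = proj₁ (proj₂ (proj₂ (does⁻ (region? (W a) g) (inRegion {a} {s} {g} p))))
      at-root : end₁ g ≡ w b ⊎ end₂ g ≡ w b → Around (W b) g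
      at-root (inj₁ eq) = around⁺ {W b} {g} Ag (inj₁ (eq , refl)) (root∈ (W b))
      at-root (inj₂ eq) = around⁺ {W b} {g} Ag (inj₂ (refl , eq)) (root∈ (W b))

corollary3 : (k : ℕ) → k ≥ 3 →
    (F : Graph) → MaxDegree≤ k F →
    (G : Graph) → EdgeConnected k G →
    (v : Vertex G) → AtLeastNeighbours G (d k * #V F) v →
    StrongImmersion F G
corollary3 (suc ρ) (s≤s 2≤ρ) F Δ≤k G conn v (S , le , neighbours) =
  Realization.realize ρ F G Δ≤k v (lookup S) C
    (Packing.select (proj₁ ∘ ends G) (proj₂ ∘ ends G) v (lookup S) S∌v ρ (≤-trans (s≤s z≤n) 2≤ρ) C
      (d (suc ρ)) (#V F) (degree-bound (suc ρ) ρ refl) (subst (d (suc ρ) * #V F ≤_) (size-lookup S) le))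
  where open Neighbourhood ρ G conn v S neighbours using (C; S∌v)
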